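{- If a graph $G$ is not chordal, then for every labeling of its vertices by $1,\ldots,n$ and every initial elimination forest $F_0$ for $G$, Algorithm R terminates before visiting all elimination forests for $G$.
   Context: A graph is chordal if every induced cycle has length three. An elimination tree for a connected graph $G$ is a rooted tree on its vertex set consisting of a root $x$ whose children are the roots of elimination trees for the components of $G-x$ (unordered). An elimination forest is one elimination tree per component. Rotation of a tree edge $\{i,j\}$, where $i$ is the parent of $j$: let $H$ be the subgraph induced by the subtree rooted at $i$. Then $j$ takes $i$'s place (child of $i$'s former parent, or root), $i$ becomes a child of $j$, subtrees of $i$ stay with $i$, and each subtree $S$ of $j$ stays with $j$ unless $S$ lies in the same component of $H-j$ as $i$, in which case it moves to $i$. Up-rotation of $j$: rotate the edge to its parent $i<j$. Down-rotation of $j$: rotate an edge to a child $i<j$. Algorithm R on $G=([n],E)$ with initial forest $F_0$: visit $F_0$. Then repeatedly, in the last visited forest, let $j$ be the largest vertex admitting an up- or down-rotation producing an unvisited forest. Terminate if no such $j$ exists, or if more than one edge $\{i,j\}$ with $i<j$ produces an unvisited forest. Otherwise perform that rotation, visit the result, and continue. -}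

module Defs where

open import Data.Nat using (ℕ; zero; suc; _≤_)
open import Data.Bool using (Bool; T; false)
open import Data.Unit using (⊤)
open import Data.Fin using (Fin; toℕ) renaming (_<_ to _<ᶠ_)
open import Data.Fin.Subset using (Subset; _∈_; _∉_)
open import Data.Maybe using (Maybe; just; nothing)
open import Data.Vec using (Vec; lookup)
open import Data.List using (List; []; _∷_)
import Data.List.Membership.Propositional as LM
open import Data.Product using (Σ; _×_; _,_)
open import Data.Sum using (_⊎_)
open import Relation.Binary.PropositionalEquality using (_≡_; _≢_)
open import Relation.Nullary using (¬_)
open import Function using (Injective; _⇔_)

-- Finite simple graphs on the vertex set Fin n (labels 0,…,n-1 play the
-- role of 1,…,n; the order on vertices is the order of Fin n).

record Graph (n : ℕ) : Set where
  field
    E     : Fin n → Fin n → Bool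
    sym   : ∀ u v → E u v ≡ E v u
    irrefl : ∀ u → E u u ≡ false

Adj : ∀ {n} → Graph n → Fin n → Fin n → Set
Adj G u v = T (Graph.E G u v)

Next : ∀ {k} → Fin k → Fin k → Set
Next {k} a b = (suc (toℕ a) ≡ toℕ b) ⊎ ((suc (toℕ a) ≡ k) × (toℕ b ≡ 0))

CycAdj : ∀ {k} → Fin k → Fin k → Set
CycAdj a b = Next a b ⊎ Next b a

InducedCycle : ∀ {n} → Graph n → (k : ℕ) → (Fin k → Fin n) → Set
InducedCycle G k c =
  (3 ≤ k) × Injective _≡_ _≡_ c × (∀ a b → (Adj G (c a) (c b) ⇔ CycAdj a b))

Chordal : ∀ {n} → Graph n → Set
Chordal G = ∀ k c → InducedCycle G k c → k ≡ 3

data Reach {n} (G : Graph n) (P : Fin n → Set) : Fin n → Fin n → Set where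
  here : ∀ {u} → P u → Reach G P u u
  step : ∀ {u w v} → P u → Adj G u w → Reach G P w v → Reach G P u v

IsComponent : ∀ {n} → Graph n → (Fin n → Set) → Subset n → Set
IsComponent G P D =
  (∀ v → v ∈ D → P v) ×
  Σ _ (λ x → x ∈ D) ×
  (∀ u v → u ∈ D → v ∈ D → Reach G (λ w → w ∈ D) u v) ×
  (∀ u v → u ∈ D → P v → Adj G u v → v ∈ D)

-- Rooted forests on Fin n, given by their parent map (nothing = root).

Forest : ℕ → Set
Forest n = Vec (Maybe (Fin n)) n

-- ET G F C a : F restricted to C is an elimination tree of G[C]
-- whose root has parent a in F.
data ET {n} (G : Graph n) (F : Forest n) : Subset n → Maybe (Fin n) → Set where
  node : ∀ {C a} (r : Fin n) → r ∈ C → lookup F r ≡ a →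
         (∀ D → IsComponent G (λ v → v ∈ C × v ≢ r) D → ET G F D (just r)) →
         ET G F C a

IsElimForest : ∀ {n} → Graph n → Forest n → Set
IsElimForest G F = ∀ D → IsComponent G (λ _ → ⊤) D → ET G F D nothing

data Desc {n} (F : Forest n) (a : Fin n) : Fin n → Set where
  self : Desc F a a
  down : ∀ {v w} → lookup F v ≡ just w → Desc F a w → Desc F a v

-- Rot G F p c F' : F' is the result of rotating the tree edge {p,c}
-- of F, where p is the parent of c.  H = G[subtree of p].
Rot : ∀ {n} → Graph n → Forest n → Fin n → Fin n → Forest n → Set
Rot G F p c F' =
  (lookup F' c ≡ lookup F p) ×
  (lookup F' p ≡ just c) ×
  (∀ v → lookup F v ≡ just c →
     (SameComp v → lookup F' v ≡ just p) × (¬ SameComp v → lookup F' v ≡ just c)) ×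
  (∀ v → v ≢ p → v ≢ c → lookup F v ≢ just c → lookup F' v ≡ lookup F v)
  where
  SameComp : _ → Set
  SameComp v = ∀ w → Desc F v w → Reach G (λ x → Desc F p x × x ≢ c) p w

RotEdge : ∀ {n} → Graph n → Forest n → Fin n → Fin n → Forest n → Set
RotEdge G F i j F' =
  (lookup F j ≡ just i × Rot G F i j F') ⊎ (lookup F i ≡ just j × Rot G F j i F')

-- Algorithm R.  V is the list of visited forests, F the last visited one.

open LM using () renaming (_∉_ to _∉ₗ_)

Fresh : ∀ {n} → Graph n → List (Forest n) → Forest n → Fin n → Fin n → Set
Fresh G V F i j = (i <ᶠ j) × Σ _ (λ F' → RotEdge G F i j F' × F' ∉ₗ V)

Admits : ∀ {n} → Graph n → List (Forest n) → Forest n → Fin n → Set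
Admits G V F j = Σ _ (λ i → Fresh G V F i j)

Largest : ∀ {n} → Graph n → List (Forest n) → Forest n → Fin n → Set
Largest G V F j = Admits G V F j × (∀ j' → j <ᶠ j' → ¬ Admits G V F j')

Step : ∀ {n} → Graph n → List (Forest n) → Forest n → Forest n → Set
Step G V F F' =
  Σ _ λ j → Σ _ λ i →
    Largest G V F j × (i <ᶠ j) × RotEdge G F i j F' × F' ∉ₗ V ×
    (∀ i' → Fresh G V F i' j → i' ≡ i)

Stop : ∀ {n} → Graph n → List (Forest n) → Forest n → Set
Stop G V F =
  (∀ j → ¬ Admits G V F j) ⊎
  Σ _ λ j → Largest G V F j ×
    Σ _ λ i₁ → Σ _ λ i₂ → i₁ ≢ i₂ × Fresh G V F i₁ j × Fresh G V F i₂ j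

-- Run G V F L : started in state (visited V, last visited F), Algorithm R
-- terminates, and L is the list of all forests visited when it does.
data Run {n} (G : Graph n) : List (Forest n) → Forest n → List (Forest n) → Set where
  stop : ∀ {V F} → Stop G V F → Run G V F V
  go   : ∀ {V F F' L} → Step G V F F' → Run G (F' ∷ V) F' L → Run G V F L

{-# OPTIONS --safe #-}
module Submission where

-- An elimination forest is recorded by the subtree A u of each vertex u; rotating {i,j} means
-- changing exactly the subtrees of i and j.  Suppose a run visits every forest, and let v be the
-- largest non-isolated vertex.  Two forests related by a rotation of v must be visited
-- consecutively, so every forest has at most two v-neighbours.
--
-- Deleting v (isolating it and splitting each subtree accordingly) is constant along rotations of v,
-- and its fibres are connected by them, hence each fibre is visited without interruption.  The last
-- forest of a fibre has at most one v-neighbour, and then all rotations of the smaller forest lift to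
-- it; therefore the sequence of fibres is again a complete run, for G - v.
--
-- Deleting the large vertices one by one we may assume that v is the largest vertex of an induced
-- cycle of length at least four.  Let x, y be its cycle neighbours and z the other cycle neighbour of
-- x.  Eliminating everything outside {v,x,y,z} first, then z, then v, gives a forest in which v has a
-- parent and two children, that is three v-neighbours: a contradiction.

open import Defs
open import Data.Bool using (Bool; T; not; _∧_)
open import Data.Bool.Properties using (∧-comm; ∧-zeroʳ)
open import Data.Empty using (⊥; ⊥-elim)
open import Data.Fin using (Fin; zero; suc; toℕ; fromℕ; fromℕ<; inject₁; _≟_; _<?_) renaming (_<_ to _<ᶠ_; _≤_ to _≤ᶠ_)
open import Data.Fin.Induction using (po-wellFounded; po-noetherian; >-wellFounded)
import Data.Fin.Properties as Finₚ
open import Data.Fin.Properties using (any?; all?; toℕ-injective; toℕ<n)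
import Data.Fin.Subset as Sub
open import Data.Fin.Subset.Properties using (_∈?_)
open import Data.List using (List; []; _∷_; _++_; filter; length; allFin; map; cartesianProductWith)
open import Data.List.Membership.Propositional using (_∈_; _∉_; find; lose)
open import Data.List.Membership.Propositional.Properties using (∈-allFin; ∈-filter⁺; ∈-map⁺; ∈-++⁺ʳ; ∈-++⁺ˡ; ∈-++⁻; ∈-cartesianProductWith⁺)
open import Data.List.Properties using (filter-notAll; ++-assoc)
import Data.List.Relation.Unary.All as All
open import Data.List.Relation.Unary.AllPairs using ([]; _∷_)
open import Data.List.Relation.Unary.Any using (here; there)
import Data.List.Relation.Unary.Any as Any
open import Data.List.Relation.Unary.Unique.Propositional using (Unique)
open import Data.Maybe using (Maybe; just; nothing)
open import Data.Maybe.Properties using (just-injective) renaming (≡-dec to maybe-≡-dec)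
import Data.Nat as ℕ
open import Data.Nat using (ℕ; zero; suc; _+_; _<_; _≤_; s≤s; s≤s⁻¹)
import Data.Nat.Properties as ℕₚ
open import Data.Nat.Properties using (m<1+n⇒m<n∨m≡n; ≤∧≢⇒<; <⇒≱; ≤-trans; ≤-refl; ≮⇒≥; ≤-antisym; m∸n+n≡m; ≤-reflexive)
open import Data.Product using (Σ; ∃; _×_; _,_; proj₁; proj₂)
open import Data.Sum using (_⊎_; inj₁; inj₂)
open import Data.Unit using (⊤; tt)
open import Data.Vec using (Vec; []; _∷_; lookup; tabulate)
open import Data.Vec.Properties using (lookup∘tabulate; tabulate∘lookup; tabulate-cong; lookup⇒[]=; []=⇒lookup) renaming (≡-dec to vec-≡-dec)
open import Function using (_∘_; id; Equivalence)
open import Induction.WellFounded using (Acc; acc; WellFounded)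
open import Relation.Binary.Construct.Closure.ReflexiveTransitive using (Star; ε; _◅_; _◅◅_)
open import Relation.Binary.Definitions using (Decidable; DecidableEquality; tri<; tri≈; tri>)
open import Relation.Binary.PropositionalEquality using (_≡_; _≢_; refl; sym; trans; cong; cong₂; subst; ≢-sym; isEquivalence)
open import Relation.Binary.Structures using (IsPartialOrder)
open import Relation.Nullary using (¬_; Dec; yes; no; ¬?; contradiction; does)
open import Relation.Nullary.Decidable using (map′; _×-dec_; _⊎-dec_; _→-dec_; ⌊_⌋; T?; decidable-stable; dec-true; dec-false)
open import Relation.Unary using (_≐_; _⊆_)

-- Decidability of reachability

-- The stopping rule is used in two ways. The largest vertex is taken, so rotations of v have
-- priority; and ties stop the run, so a step with label j leaves no other later neighbour with
-- label j or more. The inequality in `Greedy` is therefore strict, and a v-neighbour that is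
-- neither visited before nor visited next could never occur, since no label exceeds v. The obstacle
-- is lifting: a tree edge {p,c} present after the deletion of v may come from a longer path of the
-- original forest, with some q between p and c. Either q = v, or v separates c from q inside the
-- subtree of q. In the first case v has a parent and a child, which is impossible for a forest with
-- at most one v-neighbour. In the second, v is raised to the place of q, where it has a parent and
-- two children, against the bound of two. Subtrees are the right data because each is determined by
-- the proper ancestors of its root. Forests that agree outside the subtrees of i and j can thus
-- differ only in which of i and j is above, and up- and down-rotations become one symmetric
-- relation.

module Warshall {n : ℕ} {R : Fin n → Fin n → Set} (R? : Decidable R) where

  -- Warshall's dynamic program: a walk exists whose inner vertices all have number below the bound.
  Via : ℕ → Fin n → Fin n → Set
  Via zero    u v = u ≡ v ⊎ R u v
  Via (suc k) u v = Via k u v ⊎ ∃ λ m → toℕ m ≡ k × Via k u m × Via k m v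

  via? : ∀ k → Decidable (Via k)
  via? zero    u v = (u ≟ v) ⊎-dec R? u v
  via? (suc k) u v =
    via? k u v ⊎-dec any? λ m → (toℕ m ℕ.≟ k) ×-dec via? k u m ×-dec via? k m v

  via-base : ∀ k {u v} → Via zero u v → Via k u v
  via-base zero    p = p
  via-base (suc k) p = inj₁ (via-base k p)

  -- If both halves pass through the top vertex, the detour between the two visits is dropped.
  via-trans : ∀ k {u m v} → toℕ m < k → Via k u m → Via k m v → Via k u v
  via-trans (suc k) {u} {m} {v} m<k p q with m<1+n⇒m<n∨m≡n m<k
  ... | inj₂ m≡k = inj₂ (m , m≡k , left p , right q)
    where
    left : Via (suc k) u m → Via k u m
    left (inj₁ r) = r
    left (inj₂ (l , l≡k , r , _)) with refl ← toℕ-injective (trans m≡k (sym l≡k)) = r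
    right : Via (suc k) m v → Via k m v
    right (inj₁ r) = r
    right (inj₂ (l , l≡k , _ , r)) with refl ← toℕ-injective (trans m≡k (sym l≡k)) = r
  via-trans (suc k) m<k (inj₁ p) (inj₁ q) | inj₁ lt = inj₁ (via-trans k lt p q)
  via-trans (suc k) m<k (inj₁ p) (inj₂ (l , e , q , r)) | inj₁ lt =
    inj₂ (l , e , via-trans k lt p q , r)
  via-trans (suc k) m<k (inj₂ (l , e , p , q)) (inj₁ r) | inj₁ lt =
    inj₂ (l , e , p , via-trans k lt q r)
  via-trans (suc k) m<k (inj₂ (l , e , p , _)) (inj₂ (l' , e' , _ , r)) | inj₁ lt
    with refl ← toℕ-injective (trans e (sym e')) = inj₂ (l , e , p , r)

  via⇒star : ∀ k {u v} → Via k u v → Star R u v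
  via⇒star zero    (inj₁ refl)            = ε
  via⇒star zero    (inj₂ r)               = r ◅ ε
  via⇒star (suc k) (inj₁ p)               = via⇒star k p
  via⇒star (suc k) (inj₂ (_ , _ , p , q)) = via⇒star k p ◅◅ via⇒star k q

  star⇒via : ∀ {u v} → Star R u v → Via n u v
  star⇒via ε        = via-base n (inj₁ refl)
  star⇒via (r ◅ rs) = via-trans n (toℕ<n _) (via-base n (inj₂ r)) (star⇒via rs)

  abstract
    star? : Decidable (Star R)
    star? u v = map′ (via⇒star n) star⇒via (via? n u v)

-- Reachability in a graph and isolation of a vertex

module _ {n : ℕ} where

  desc⇒star : ∀ {F : Forest n} {a v} → Desc F a v → Star (λ x y → lookup F x ≡ just y) v a
  desc⇒star self       = ε
  desc⇒star (down e d) = e ◅ desc⇒star d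

  star⇒desc : ∀ {F : Forest n} {a v} → Star (λ x y → lookup F x ≡ just y) v a → Desc F a v
  star⇒desc ε        = self
  star⇒desc (e ◅ es) = down e (star⇒desc es)

  desc? : (F : Forest n) → Decidable (Desc F)
  desc? F a v =
    map′ star⇒desc desc⇒star (Warshall.star? (λ x y → maybe-≡-dec _≟_ (lookup F x) (just y)) v a)

  abstract
    forest-≟ : DecidableEquality (Forest n)
    forest-≟ = vec-≡-dec (maybe-≡-dec _≟_)

  adj? : (G : Graph n) → Decidable (Adj G)
  adj? G u v = T? (Graph.E G u v)

  adj-sym : (G : Graph n) → ∀ {u v} → Adj G u v → Adj G v u
  adj-sym G {u} {v} = subst T (Graph.sym G u v)

  adj-irrefl : (G : Graph n) → ∀ {u} → ¬ Adj G u u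
  adj-irrefl G {u} = subst T (Graph.irrefl G u)

  _≤ᴳ_ : Graph n → Graph n → Set
  H ≤ᴳ G = ∀ {u v} → Adj H u v → Adj G u v

  module _ {G : Graph n} {P : Fin n → Set} where

    reach⇒star : ∀ {u v} → Reach G P u v → P u × Star (λ x y → Adj G x y × P y) u v
    reach⇒star (here p) = p , ε
    reach⇒star (step p e r) with q , s ← reach⇒star r = p , (e , q) ◅ s

    star⇒reach : ∀ {u v} → P u → Star (λ x y → Adj G x y × P y) u v → Reach G P u v
    star⇒reach p ε              = here p
    star⇒reach p ((e , q) ◅ s)  = step p e (star⇒reach q s)

    reach? : (∀ x → Dec (P x)) → Decidable (Reach G P)
    reach? P? u v =
      map′ (λ (p , s) → star⇒reach p s) reach⇒star
        (P? u ×-dec Warshall.star? (λ x y → adj? G x y ×-dec P? y) u v)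

    reach-source : ∀ {u v} → Reach G P u v → P u
    reach-source (here p)     = p
    reach-source (step p _ _) = p

    reach-target : ∀ {u v} → Reach G P u v → P v
    reach-target (here p)     = p
    reach-target (step _ _ r) = reach-target r

    reach-trans : ∀ {u v w} → Reach G P u v → Reach G P v w → Reach G P u w
    reach-trans (here _)     s = s
    reach-trans (step p e r) s = step p e (reach-trans r s)

    reach-snoc : ∀ {u v w} → Reach G P u v → Adj G v w → P w → Reach G P u w
    reach-snoc r e p = reach-trans r (step (reach-target r) e (here p))

    reach-sym : ∀ {u v} → Reach G P u v → Reach G P v u
    reach-sym (here p)     = here p
    reach-sym (step p e r) = reach-snoc (reach-sym r) (adj-sym G e) p

    reach-restrict : {Q : Fin n → Set} →
      (∀ {x y} → Q x → P x → P y → Adj G x y → Q y) →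
      ∀ {u v} → Q u → Reach G P u v → Reach G (λ x → P x × Q x) u v
    reach-restrict cl q (here p)     = here (p , q)
    reach-restrict cl q (step p e r) =
      step (p , q) e (reach-restrict cl (cl q p (reach-source r) e) r)

  reach-map : {G H : Graph n} {P Q : Fin n → Set} → G ≤ᴳ H → P ⊆ Q →
              ∀ {u v} → Reach G P u v → Reach H Q u v
  reach-map f g (here p)     = here (g p)
  reach-map f g (step p e r) = step (g p) (f e) (reach-map f g r)

  reach-mono : {G : Graph n} {P Q : Fin n → Set} → P ⊆ Q →
               ∀ {u v} → Reach G P u v → Reach G Q u v
  reach-mono = reach-map (λ e → e)

  -- Each vertex of the walk is reached by an initial segment of it. This yields `conn` whenever a
  -- subtree is defined as a component.
  reach-self : {G : Graph n} {P : Fin n → Set} →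
               ∀ {u v} → Reach G P u v → Reach G (Reach G P u) u v
  reach-self r = reach-mono proj₂
    (reach-restrict (λ q _ py e → reach-snoc q e py) (here (reach-source r)) r)

  -- Deletion of a vertex on an unchanged vertex set, so that labels and types stay the same when
  -- deletions are iterated.
  isolate : Fin n → Graph n → Graph n
  isolate v G = record
    { E      = λ x y → keep x y ∧ Graph.E G x y
    ; sym    = λ x y → cong₂ _∧_ (∧-comm (not ⌊ x ≟ v ⌋) _) (Graph.sym G x y)
    ; irrefl = λ x → trans (cong (keep x x ∧_) (Graph.irrefl G x)) (∧-zeroʳ (keep x x))
    }
    where
    keep : Fin n → Fin n → Bool
    keep x y = not ⌊ x ≟ v ⌋ ∧ not ⌊ y ≟ v ⌋

  module _ (G : Graph n) {v : Fin n} where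

    isolate-adj⁺ : ∀ {x y} → x ≢ v → y ≢ v → Adj G x y → Adj (isolate v G) x y
    isolate-adj⁺ {x} {y} x≢v y≢v e with x ≟ v | y ≟ v
    ... | yes p | _     = contradiction p x≢v
    ... | no _  | yes p = contradiction p y≢v
    ... | no _  | no _  = e

    isolate-adj⁻ : ∀ {x y} → Adj (isolate v G) x y → x ≢ v × y ≢ v × Adj G x y
    isolate-adj⁻ {x} {y} e with x ≟ v | y ≟ v
    ... | no p | no q = p , q , e

    isolate-≤ : isolate v G ≤ᴳ G
    isolate-≤ = proj₂ ∘ proj₂ ∘ isolate-adj⁻

    reach-avoid : {P : Fin n → Set} → ¬ P v → ∀ {x y} → Reach G P x y → Reach (isolate v G) P x y
    reach-avoid ¬p (here p) = here p
    reach-avoid {P} ¬p (step p e r) =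
      step p (isolate-adj⁺ (λ { refl → ¬p p }) (λ { refl → ¬p (reach-source r) }) e) (reach-avoid ¬p r)

    reach-isolate : {P : Fin n → Set} → ∀ {x y} → x ≢ v → Reach (isolate v G) P x y →
                    Reach G (λ z → P z × z ≢ v) x y
    reach-isolate x≢v r = reach-map isolate-≤ (λ p → p)
      (reach-restrict (λ _ _ _ e → proj₁ (proj₂ (isolate-adj⁻ e))) x≢v r)

  -- The family of subtrees of an elimination forest: A u v says that v lies in the subtree of u.
  record Tubing (G : Graph n) (A : Fin n → Fin n → Set) : Set where
    field
      rfl     : ∀ {u} → A u u
      antisym : ∀ {u v} → A u v → A v u → u ≡ v
      tr      : ∀ {u v w} → A u v → A v w → A u w
      chain   : ∀ {u v w} → A u w → A v w → A u v ⊎ A v u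
      adj     : ∀ {u v} → Adj G u v → A u v ⊎ A v u
      conn    : ∀ {u v} → A u v → Reach G (A u) u v

    isPartialOrder : IsPartialOrder _≡_ A
    isPartialOrder = record
      { isPreorder = record
        { isEquivalence = isEquivalence
        ; reflexive     = λ { refl → rfl }
        ; trans         = tr
        }
      ; antisym = antisym
      }

    ancestors-wf : WellFounded (λ x y → A x y × x ≢ y)
    ancestors-wf = po-wellFounded isPartialOrder

    descendants-wf : WellFounded (λ y x → A x y × x ≢ y)
    descendants-wf = po-noetherian isPartialOrder

    -- The subtree of u is the component of u in G minus the proper ancestors of u.
    tube⁺ : ∀ {u v} → Reach G (λ x → A x u → x ≡ u) u v → A u v
    tube⁺ {u} r = proj₂ (reach-target (reach-restrict grow rfl r))
      where
      grow : ∀ {x y} → A u x → (A x u → x ≡ u) → (A y u → y ≡ u) → Adj G x y → A u y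
      grow ux _ py e with adj e
      ... | inj₁ xy = tr ux xy
      ... | inj₂ yx with chain ux yx
      ...   | inj₁ uy = uy
      ...   | inj₂ yu = subst (A u) (sym (py yu)) rfl

    tube⁻ : ∀ {u v} → A u v → Reach G (λ x → A x u → x ≡ u) u v
    tube⁻ uv = reach-mono (λ ux xu → antisym xu ux) (conn uv)

  tubing-resp : ∀ {G A B} → (∀ u → A u ≐ B u) → Tubing G A → Tubing G B
  tubing-resp {G} {A} {B} eq t = record
    { rfl     = to T.rfl
    ; antisym = λ p q → T.antisym (from p) (from q)
    ; tr      = λ p q → to (T.tr (from p) (from q))
    ; chain   = λ p q → both (T.chain (from p) (from q))
    ; adj     = λ e → both (T.adj e)
    ; conn    = λ p → reach-mono to (T.conn (from p))
    }
    where
    module T = Tubing t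
    to : ∀ {u v} → A u v → B u v
    to {u} = proj₁ (eq u)
    from : ∀ {u v} → B u v → A u v
    from {u} = proj₂ (eq u)
    both : ∀ {u v} → A u v ⊎ A v u → B u v ⊎ B v u
    both (inj₁ p) = inj₁ (to p)
    both (inj₂ p) = inj₂ (to p)

  Par : (Fin n → Fin n → Set) → Fin n → Fin n → Set
  Par A p v = A p v × p ≢ v × (∀ q → A q v → q ≢ v → A q p)

  par? : ∀ {A} → Decidable A → Decidable (Par A)
  par? A? p v = A? p v ×-dec ¬? (p ≟ v) ×-dec all? λ q → A? q v →-dec (¬? (q ≟ v) →-dec A? q p)

  module _ {G : Graph n} {A : Fin n → Fin n → Set} (t : Tubing G A) where
    open Tubing t

    par-unique : ∀ {p q v} → Par A p v → Par A q v → p ≡ q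
    par-unique (pv , p≢v , pm) (qv , q≢v , qm) = antisym (qm _ pv p≢v) (pm _ qv q≢v)

    module _ (A? : Decidable A) where

      par-exists : ∀ {u v} → A u v → u ≢ v → ∃ λ p → Par A p v
      par-exists {u} {v} = loop u (descendants-wf u)
        where
        loop : ∀ u → Acc (λ y x → A x y × x ≢ y) u → A u v → u ≢ v → ∃ λ p → Par A p v
        loop u (acc rs) uv u≢v with any? (λ q → A? q v ×-dec ¬? (q ≟ v) ×-dec ¬? (A? q u))
        ... | no none = u , uv , u≢v , λ q qv q≢v →
                decidable-stable (A? q u) λ ¬qu → none (q , qv , q≢v , ¬qu)
        ... | yes (q , qv , q≢v , ¬qu) with chain qv uv
        ...   | inj₁ qu = contradiction qu ¬qu
        ...   | inj₂ uq = loop q (rs (uq , λ { refl → ¬qu rfl })) qv q≢v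

      child-exists : ∀ {u v} → A u v → u ≢ v → ∃ λ c → Par A u c × A c v
      child-exists {u} {v} uv u≢v = loop v (ancestors-wf v) uv u≢v rfl
        where
        loop : ∀ x → Acc (λ x y → A x y × x ≢ y) x → A u x → u ≢ x → A x v → ∃ λ c → Par A u c × A c v
        loop x (acc rs) ux u≢x xv with par-exists ux u≢x
        ... | p , pp@(px , p≢x , pm) with u ≟ p
        ...   | yes refl = x , pp , xv
        ...   | no u≢p   = loop p (rs (px , p≢x)) (pm u ux u≢x) u≢p (tr px xv)

  -- Passing between families of subtrees and parent maps

  module Realise {A : Fin n → Fin n → Set} (A? : Decidable A) where

    parent : ∀ v → Dec (∃ λ p → Par A p v) → Maybe (Fin n)
    parent v (yes (p , _)) = just p
    parent v (no _)        = nothing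

    abstract
      realise : Forest n
      realise = tabulate λ v → parent v (any? λ p → par? A? p v)

      realise-lookup : ∀ v → lookup realise v ≡ parent v (any? λ p → par? A? p v)
      realise-lookup v = lookup∘tabulate _ v

    module _ {G : Graph n} (t : Tubing G A) where
      open Tubing t

      realise⇒par : ∀ {v p} → lookup realise v ≡ just p → Par A p v
      realise⇒par {v} e with any? (λ p → par? A? p v) | trans (sym (realise-lookup v)) e
      ... | yes (_ , par) | refl = par

      par⇒realise : ∀ {v p} → Par A p v → lookup realise v ≡ just p
      par⇒realise {v} {p} par = trans (realise-lookup v) (loop (any? λ q → par? A? q v))
        where
        loop : (d : Dec (∃ λ q → Par A q v)) → parent v d ≡ just p
        loop (yes (q , par')) = cong just (par-unique t par' par)
        loop (no none)        = contradiction (p , par) none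

      desc⇒ : ∀ {u v} → Desc realise u v → A u v
      desc⇒ self       = rfl
      desc⇒ (down e d) = tr (desc⇒ d) (proj₁ (realise⇒par e))

      ⇒desc : ∀ {u v} → A u v → Desc realise u v
      ⇒desc {u} {v} = loop v (ancestors-wf v)
        where
        loop : ∀ v → Acc (λ x y → A x y × x ≢ y) v → A u v → Desc realise u v
        loop v (acc rs) uv with u ≟ v
        ... | yes refl = self
        ... | no u≢v with par-exists t A? uv u≢v
        ...   | p , par@(pv , p≢v , pm) = down (par⇒realise par) (loop p (rs (pv , p≢v)) (pm u uv u≢v))

      realise-≐ : ∀ u → Desc realise u ≐ A u
      realise-≐ u = desc⇒ , ⇒desc

  -- The second clause is separate because `Desc` does not see a loop: a vertex that is its own
  -- parent has the same subtrees as a root.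
  Good : Graph n → Forest n → Set
  Good G F = Tubing G (Desc F) × (∀ v → lookup F v ≢ just v)

  realise-good : ∀ {G : Graph n} {A} (A? : Decidable A) → Tubing G A → Good G (Realise.realise A?)
  realise-good A? t =
    tubing-resp (λ u → proj₂ (realise-≐ t u) , proj₁ (realise-≐ t u)) t ,
    λ v e → proj₁ (proj₂ (realise⇒par t e)) refl
    where open Realise A?

  desc-trans : ∀ {F : Forest n} {u v w} → Desc F u v → Desc F v w → Desc F u w
  desc-trans d self        = d
  desc-trans d (down e d') = down e (desc-trans d d')

  desc-chain : ∀ {F : Forest n} {u v w} → Desc F u w → Desc F v w → Desc F u v ⊎ Desc F v u
  desc-chain self        d'       = inj₂ d'
  desc-chain d@(down _ _) self    = inj₁ d
  desc-chain (down e d) (down e' d') with refl ← just-injective (trans (sym e) e') = desc-chain d d'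

  module _ {G : Graph n} {F : Forest n} (g : Good G F) where

    lookup⇒par : ∀ {v p} → lookup F v ≡ just p → Par (Desc F) p v
    lookup⇒par {v} {p} e = down e self , (λ { refl → proj₂ g p e }) , minimal
      where
      minimal : ∀ q → Desc F q v → q ≢ v → Desc F q p
      minimal q self        q≢v = contradiction refl q≢v
      minimal q (down e' d) _   = subst (Desc F q) (just-injective (trans (sym e') e)) d

    par⇒lookup : ∀ {v p} → Par (Desc F) p v → lookup F v ≡ just p
    par⇒lookup (self , p≢v , _) = contradiction refl p≢v
    par⇒lookup par@(down e _ , _) = trans e (cong just (par-unique (proj₁ g) (lookup⇒par e) par))

  just-ext : {x y : Maybe (Fin n)} → (∀ q → x ≡ just q → y ≡ just q) →
             (∀ q → y ≡ just q → x ≡ just q) → x ≡ y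
  just-ext {just a}  {y}       f g = sym (f a refl)
  just-ext {nothing} {just b}  f g = g b refl
  just-ext {nothing} {nothing} f g = refl

  lookup-ext : {F F' : Forest n} → (∀ v → lookup F v ≡ lookup F' v) → F ≡ F'
  lookup-ext {F} {F'} eq =
    trans (sym (tabulate∘lookup F)) (trans (tabulate-cong eq) (tabulate∘lookup F'))

  par-resp : ∀ {A B : Fin n → Fin n → Set} → (∀ u → A u ≐ B u) → ∀ {p v} → Par A p v → Par B p v
  par-resp eq (pv , p≢v , m) =
    proj₁ (eq _) pv , p≢v , λ q qv q≢v → proj₁ (eq q) (m q (proj₂ (eq q) qv) q≢v)

  good-ext : ∀ {G F F'} → Good G F → Good G F' → (∀ u → Desc F u ≐ Desc F' u) → F ≡ F'
  good-ext g g' eq = lookup-ext λ v → just-ext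
    (λ q e → par⇒lookup g' (par-resp eq (lookup⇒par g e)))
    (λ q e → par⇒lookup g (par-resp (λ u → proj₂ (eq u) , proj₁ (eq u)) (lookup⇒par g' e)))

-- Rotations as changes of two subtrees

module _ {n : ℕ} where

  AgreeOff : Fin n → Fin n → Forest n → Forest n → Set
  AgreeOff i j F F' = ∀ u → u ≢ i → u ≢ j → Desc F u ≐ Desc F' u

  agreeOff-sym : ∀ {i j F F'} → AgreeOff i j F F' → AgreeOff i j F' F
  agreeOff-sym ag u u≢i u≢j = proj₂ (ag u u≢i u≢j) , proj₁ (ag u u≢i u≢j)

  agreeOff-trans : ∀ {i j F F' F''} → AgreeOff i j F F' → AgreeOff i j F' F'' → AgreeOff i j F F''
  agreeOff-trans ag ag' u u≢i u≢j =
    proj₁ (ag' u u≢i u≢j) ∘ proj₁ (ag u u≢i u≢j) , proj₂ (ag u u≢i u≢j) ∘ proj₂ (ag' u u≢i u≢j)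

  agreeOff-swap : ∀ {i j F F'} → AgreeOff i j F F' → AgreeOff j i F F'
  agreeOff-swap ag u u≢i u≢j = ag u u≢j u≢i

  module _ {G : Graph n} where

    -- By `tube⁺` and `tube⁻` the subtree of i depends only on the proper ancestors of i. Off i and
    -- j these are common to both forests, so all that matters is whether j is above i.
    tube-⊆ : ∀ {i j F F'} → Good G F → Good G F' → AgreeOff i j F F' →
             (Desc F' j i → Desc F j i) → Desc F i ⊆ Desc F' i
    tube-⊆ {i} {j} {F} {F'} g g' ag ji {w} iw = T'.tube⁺ (reach-mono avoids (T.tube⁻ iw))
      where
      module T  = Tubing (proj₁ g)
      module T' = Tubing (proj₁ g')
      avoids : ∀ {x} → (Desc F x i → x ≡ i) → Desc F' x i → x ≡ i
      avoids {x} f d with x ≟ i | x ≟ j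
      ... | yes eq | _        = eq
      ... | no _   | yes refl = f (ji d)
      ... | no x≢i | no x≢j   = f (proj₂ (ag x x≢i x≢j) d)

    tube-≐ : ∀ {i j F F'} → Good G F → Good G F' → AgreeOff i j F F' →
             (Desc F j i → Desc F' j i) → (Desc F' j i → Desc F j i) → Desc F i ≐ Desc F' i
    tube-≐ g g' ag to from = tube-⊆ g g' ag from , tube-⊆ g' g (agreeOff-sym ag) to

    -- Whether j is above i settles the subtree of i; this settles whether i is above j, and with it
    -- the subtree of j.
    agreeOff-≡ : ∀ {i j F F'} → Good G F → Good G F' → AgreeOff i j F F' →
                 (Desc F j i → Desc F' j i) → (Desc F' j i → Desc F j i) → F ≡ F'
    agreeOff-≡ {i} {j} {F} {F'} g g' ag to from = good-ext g g' tubes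
      where
      eqᵢ = tube-≐ g g' ag to from
      eqⱼ = tube-≐ g g' (agreeOff-swap ag) (proj₁ eqᵢ) (proj₂ eqᵢ)
      tubes : ∀ u → Desc F u ≐ Desc F' u
      tubes u with u ≟ i | u ≟ j
      ... | yes refl | _        = eqᵢ
      ... | no _     | yes refl = eqⱼ
      ... | no u≢i   | no u≢j   = ag u u≢i u≢j

    agreeOff-one : ∀ {i F F'} → Good G F → Good G F' → AgreeOff i i F F' → F ≡ F'
    agreeOff-one g g' ag = agreeOff-≡ g g' ag (λ _ → self) (λ _ → self)

    -- An ancestor q of j other than i and j keeps its subtree. In `F'` it is above j, hence above
    -- i, and this carries back to `F`.
    agreeOff-flip : ∀ {i j F F'} → Good G F → Good G F' → AgreeOff i j F F' →
                    Desc F i j → Desc F' j i → i ≢ j → Par (Desc F) i j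
    agreeOff-flip {i} {j} {F} {F'} g g' ag ij ji i≢j = ij , i≢j , minimal
      where
      module T' = Tubing (proj₁ g')
      minimal : ∀ q → Desc F q j → q ≢ j → Desc F q i
      minimal q qj q≢j with q ≟ i
      ... | yes refl = self
      ... | no q≢i   = proj₂ (ag q q≢i q≢j) (T'.tr (proj₁ (ag q q≢i q≢j) qj) ji)

    Flipped : Fin n → Fin n → Forest n → Forest n → Set
    Flipped p c F F' = Par (Desc F) p c × Par (Desc F') c p

    -- If either of the relations "i above j" and "j above i" is unchanged, the forests coincide. So
    -- both change, and antisymmetry leaves only an exchange of the two.
    agreeOff-cases : ∀ {i j F F'} → Good G F → Good G F' → AgreeOff i j F F' → F ≢ F' →
                     Flipped i j F F' ⊎ Flipped j i F F'
    agreeOff-cases {i} {j} {F} {F'} g g' ag F≢F' with i ≟ j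
    ... | yes refl = contradiction (agreeOff-one g g' ag) F≢F'
    ... | no i≢j
      with desc? F i j | desc? F' i j | desc? F j i | desc? F' j i
    ... | yes p | yes q | _ | _ = contradiction (agreeOff-≡ g g' (agreeOff-swap ag) (λ _ → q) (λ _ → p)) F≢F'
    ... | no p  | no q  | _ | _ =
      contradiction (agreeOff-≡ g g' (agreeOff-swap ag) (⊥-elim ∘ p) (⊥-elim ∘ q)) F≢F'
    ... | yes _ | no _  | yes p | yes q = contradiction (agreeOff-≡ g g' ag (λ _ → q) (λ _ → p)) F≢F'
    ... | no _  | yes _ | yes p | yes q = contradiction (agreeOff-≡ g g' ag (λ _ → q) (λ _ → p)) F≢F'
    ... | yes _ | no _  | no p  | no q  =
      contradiction (agreeOff-≡ g g' ag (⊥-elim ∘ p) (⊥-elim ∘ q)) F≢F'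
    ... | no _  | yes _ | no p  | no q  =
      contradiction (agreeOff-≡ g g' ag (⊥-elim ∘ p) (⊥-elim ∘ q)) F≢F'
    ... | yes ij | no _ | yes ji | no _ = contradiction (Tubing.antisym (proj₁ g) ij ji) i≢j
    ... | no _ | yes ij | no _ | yes ji = contradiction (Tubing.antisym (proj₁ g') ij ji) i≢j
    ... | yes ij | no _ | no _ | yes ji =
      inj₁ (agreeOff-flip g g' ag ij ji i≢j
           , agreeOff-flip g' g (agreeOff-sym (agreeOff-swap ag)) ji ij (≢-sym i≢j))
    ... | no _ | yes ij | yes ji | no _ =
      inj₂ (agreeOff-flip g g' (agreeOff-swap ag) ji ij (≢-sym i≢j)
           , agreeOff-flip g' g (agreeOff-sym ag) ij ji i≢j)

    par-asym : ∀ {F p c} → Good G F → Par (Desc F) p c → ¬ Desc F c p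
    par-asym g (pc , p≢c , _) cp = p≢c (Tubing.antisym (proj₁ g) pc cp)

    flipped-unique : ∀ {p c F F' F''} → Good G F → Good G F' → Good G F'' →
                     AgreeOff p c F F' → AgreeOff p c F F'' → Desc F' c p → Desc F'' c p → F' ≡ F''
    flipped-unique {F' = F'} {F''} g g' g'' ag ag' cp cp' =
      agreeOff-≡ g' g'' (agreeOff-trans (agreeOff-sym ag) ag') (λ _ → cp') (λ _ → cp)

  -- Deleting v from a forest, inserting it, and raising it

  module Contract (G : Graph n) (v : Fin n) where

    -- Of its old subtree, u keeps the piece that still contains it; for u = v this is v alone.
    Contracted : (Fin n → Fin n → Set) → Fin n → Fin n → Set
    Contracted A u w = Reach (isolate v G) (A u) u w

    contracted-tubing : ∀ {A} → Tubing G A → Tubing (isolate v G) (Contracted A)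
    contracted-tubing {A} t = record
      { rfl     = here T.rfl
      ; antisym = λ p q → T.antisym (reach-target p) (reach-target q)
      ; tr      = λ p q → reach-trans p (reach-mono (T.tr (reach-target p)) q)
      ; chain   = chain
      ; adj     = adj
      ; conn    = reach-self
      }
      where
      module T = Tubing t
      chain : ∀ {u x w} → Contracted A u w → Contracted A x w → Contracted A u x ⊎ Contracted A x u
      chain p q with T.chain (reach-target p) (reach-target q)
      ... | inj₁ ux = inj₁ (reach-trans p (reach-sym (reach-mono (T.tr ux) q)))
      ... | inj₂ xu = inj₂ (reach-trans q (reach-sym (reach-mono (T.tr xu) p)))
      adj : ∀ {u x} → Adj (isolate v G) u x → Contracted A u x ⊎ Contracted A x u
      adj e with T.adj (isolate-≤ G e)
      ... | inj₁ ux = inj₁ (step T.rfl e (here ux))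
      ... | inj₂ xu = inj₂ (step T.rfl (adj-sym (isolate v G) e) (here xu))

    contracted? : (F : Forest n) → Decidable (Contracted (Desc F))
    contracted? F u w = reach? (desc? F u) u w

    contract : Forest n → Forest n
    contract F = Realise.realise (contracted? F)

    module _ {F : Forest n} (g : Good G F) where

      contract-≐ : ∀ u → Desc (contract F) u ≐ Contracted (Desc F) u
      contract-≐ = Realise.realise-≐ (contracted? F) (contracted-tubing (proj₁ g))

      contract-good : Good (isolate v G) (contract F)
      contract-good = realise-good (contracted? F) (contracted-tubing (proj₁ g))

      contract-⊆ : ∀ {u w} → Desc (contract F) u w → Desc F u w
      contract-⊆ d = reach-target (proj₁ (contract-≐ _) d)

      contract-avoid : ∀ {u} → ¬ Desc F u v → Desc F u ⊆ Desc (contract F) u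
      contract-avoid ¬uv d = proj₂ (contract-≐ _) (reach-avoid G ¬uv (Tubing.conn (proj₁ g) d))

    isolated-desc : ∀ {T u} → Good (isolate v G) T → Desc T u v → u ≡ v
    isolated-desc {T} {u} g d with u ≟ v
    ... | yes eq = eq
    ... | no u≢v = contradiction refl (proj₂ (reach-target (reach-isolate G u≢v (Tubing.conn (proj₁ g) d))))

    isolated-desc′ : ∀ {T u} → Good (isolate v G) T → Desc T v u → u ≡ v
    isolated-desc′ g d with Tubing.conn (proj₁ g) d
    ... | here _     = refl
    ... | step _ e _ = contradiction refl (proj₁ (isolate-adj⁻ G e))

    contract-agreeOff : ∀ {F F' i j} → Good G F → Good G F' → AgreeOff i j F F' →
                        AgreeOff i j (contract F) (contract F')
    contract-agreeOff g g' ag u u≢i u≢j =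
      proj₂ (contract-≐ g' u) ∘ reach-mono (proj₁ (ag u u≢i u≢j)) ∘ proj₁ (contract-≐ g u) ,
      proj₂ (contract-≐ g u) ∘ reach-mono (proj₂ (ag u u≢i u≢j)) ∘ proj₁ (contract-≐ g' u)

    -- The subtree of v always contracts to v alone, so only that of i could differ, and by
    -- `agreeOff-one` a single subtree cannot change by itself.
    contract-≡ : ∀ {F F' i} → Good G F → Good G F' → AgreeOff i v F F' → contract F ≡ contract F'
    contract-≡ {F} {F'} {i} g g' ag = agreeOff-one (contract-good g) (contract-good g') off
      where
      single : ∀ {F F'} → Good G F → Good G F' → Desc (contract F) v ⊆ Desc (contract F') v
      single g g' d with refl ← isolated-desc′ (contract-good g) d = self
      off : AgreeOff i i (contract F) (contract F')
      off u u≢i _ with u ≟ v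
      ... | yes refl = single g g' , single g' g
      ... | no u≢v   = contract-agreeOff g g' ag u u≢i u≢v

    -- A section of contraction: v is eliminated before the rest of its component, and every other
    -- subtree is taken from the forest without v.
    data Rooted (A : Fin n → Fin n → Set) : Fin n → Fin n → Set where
      root  : ∀ {w} → Reach G (λ _ → ⊤) v w → Rooted A v w
      below : ∀ {u w} → u ≢ v → A u w → Rooted A u w

    module _ {T : Forest n} (g : Good (isolate v G) T) where
      private
        module T = Tubing (proj₁ g)
        A = Desc T

      desc⇒reach : ∀ {u w} → A u w → Reach G (λ _ → ⊤) u w
      desc⇒reach d = reach-map (isolate-≤ G) _ (T.conn d)

      rooted-tubing : Tubing G (Rooted A)
      rooted-tubing = record
        { rfl = rfl ; antisym = antisym ; tr = tr ; chain = chain ; adj = adj ; conn = conn }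
        where
        rfl : ∀ {u} → Rooted A u u
        rfl {u} with u ≟ v
        ... | yes refl = root (here tt)
        ... | no u≢v   = below u≢v self
        antisym : ∀ {u w} → Rooted A u w → Rooted A w u → u ≡ w
        antisym (root _)    (root _)    = refl
        antisym (root _)    (below _ d) = sym (isolated-desc g d)
        antisym (below _ d) (root _)    = isolated-desc g d
        antisym (below _ d) (below _ e) = T.antisym d e
        tr : ∀ {u w x} → Rooted A u w → Rooted A w x → Rooted A u x
        tr (root r)      (root s)    = root s
        tr (root r)      (below _ d) = root (reach-trans r (desc⇒reach d))
        tr (below u≢v d) (root _)    = contradiction (isolated-desc g d) u≢v
        tr (below u≢v d) (below _ e) = below u≢v (T.tr d e)
        chain : ∀ {u x w} → Rooted A u w → Rooted A x w → Rooted A u x ⊎ Rooted A x u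
        chain (root _) (root _) = inj₁ rfl
        chain (root r) (below _ d) = inj₁ (root (reach-trans r (reach-sym (desc⇒reach d))))
        chain (below _ d) (root r) = inj₂ (root (reach-trans r (reach-sym (desc⇒reach d))))
        chain (below u≢v d) (below x≢v e) with T.chain d e
        ... | inj₁ p = inj₁ (below u≢v p)
        ... | inj₂ p = inj₂ (below x≢v p)
        adj : ∀ {u x} → Adj G u x → Rooted A u x ⊎ Rooted A x u
        adj {u} {x} e with u ≟ v | x ≟ v
        ... | yes refl | _ = inj₁ (root (step tt e (here tt)))
        ... | no _ | yes refl = inj₂ (root (step tt (adj-sym G e) (here tt)))
        ... | no u≢v | no x≢v with T.adj (isolate-adj⁺ G u≢v x≢v e)
        ...   | inj₁ p = inj₁ (below u≢v p)
        ...   | inj₂ p = inj₂ (below x≢v p)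
        conn : ∀ {u w} → Rooted A u w → Reach G (Rooted A u) u w
        conn (root r)      = reach-mono root (reach-self r)
        conn (below u≢v d) = reach-map (isolate-≤ G) (below u≢v) (T.conn d)

      rooted? : Decidable (Rooted A)
      rooted? u w with u ≟ v
      ... | yes refl = map′ root (λ { (root r) → r ; (below v≢v _) → contradiction refl v≢v })
                         (reach? (λ _ → yes tt) v w)
      ... | no u≢v   = map′ (below u≢v) (λ { (root _) → contradiction refl u≢v ; (below _ d) → d })
                         (desc? T u w)

      insert : ∃ λ F → Good G F × (∀ u → Desc F u ≐ Rooted A u)
      insert = Realise.realise rooted? , realise-good rooted? rooted-tubing , Realise.realise-≐ rooted? rooted-tubing

    -- In the forest with v inserted as a root no other subtree contains v, so deleting v again
    -- splits nothing.
    contract-surjective : ∀ {T} → Good (isolate v G) T → ∃ λ F → Good G F × contract F ≡ T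
    contract-surjective {T} g with insert g
    ... | F , gF , eq = F , gF , good-ext (contract-good gF) g tubes
      where
      to : ∀ u → Desc (contract F) u ⊆ Desc T u
      to u d with proj₁ (eq u) (contract-⊆ gF d)
      ... | below _ e = e
      ... | root _ with refl ← isolated-desc′ (contract-good gF) d = self
      from : ∀ u → Desc T u ⊆ Desc (contract F) u
      from u d with u ≟ v
      ... | yes refl with refl ← isolated-desc′ g d = self
      from u d | no u≢v = contract-avoid gF away (proj₂ (eq u) (below u≢v d))
        where
        away : ¬ Desc F u v
        away e with proj₁ (eq u) e
        ... | root _    = u≢v refl
        ... | below _ f = u≢v (isolated-desc g f)
      tubes : ∀ u → Desc (contract F) u ≐ Desc T u
      tubes u = to u , from u

    -- When v is a root, contraction leaves all subtrees but that of v intact, and the one of v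
    -- cannot differ alone.
    contract-root-injective : ∀ {F F'} → Good G F → Good G F' →
      (∀ u → Desc F u v → u ≡ v) → (∀ u → Desc F' u v → u ≡ v) → contract F ≡ contract F' → F ≡ F'
    contract-root-injective {F} {F'} g g' top top' eq =
      agreeOff-one {i = v} g g' λ u u≢v _ → half g g' top eq u≢v , half g' g top' (sym eq) u≢v
      where
      half : ∀ {F F'} → Good G F → Good G F' → (∀ u → Desc F u v → u ≡ v) → contract F ≡ contract F' →
             ∀ {u} → u ≢ v → Desc F u ⊆ Desc F' u
      half g g' top eq {u} u≢v d = contract-⊆ g' (subst (λ F → Desc F u _) eq
        (contract-avoid g (u≢v ∘ top u) d))

    -- Moving v upwards until it takes the place of its ancestor q.
    module Raise {F : Forest n} (g : Good G F) {q : Fin n} (qv : Desc F q v) where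
      private
        module T = Tubing (proj₁ g)
        A = Desc F
        C = Tubing.chain (contracted-tubing (proj₁ g))

      data Raised : Fin n → Fin n → Set where
        top     : ∀ {w} → A q w → Raised v w
        inside  : ∀ {u w} → u ≢ v → A q u → Contracted A u w → Raised u w
        outside : ∀ {u w} → u ≢ v → ¬ A q u → A u w → Raised u w

      above-q : ∀ {u w} → ¬ A q u → A q w → A u w → A u q
      above-q ¬qu qw uw with T.chain qw uw
      ... | inj₁ qu = contradiction qu ¬qu
      ... | inj₂ uq = uq

      stays : ∀ {u w} → u ≢ v → Contracted A u w → w ≢ v
      stays u≢v c = proj₂ (reach-target (reach-isolate G u≢v c))

      raised-tubing : Tubing G Raised
      raised-tubing = record
        { rfl = rfl ; antisym = antisym ; tr = tr ; chain = chain ; adj = adj ; conn = conn }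
        where
        rfl : ∀ {u} → Raised u u
        rfl {u} with u ≟ v | desc? F q u
        ... | yes refl | _     = top qv
        ... | no u≢v | yes qu  = inside u≢v qu (here self)
        ... | no u≢v | no ¬qu  = outside u≢v ¬qu self
        antisym : ∀ {u w} → Raised u w → Raised w u → u ≡ w
        antisym (top _) (top _) = refl
        antisym (top _) (inside w≢v _ c) = contradiction refl (stays w≢v c)
        antisym (top qw) (outside _ ¬qw _) = contradiction qw ¬qw
        antisym (inside u≢v _ c) (top _) = contradiction refl (stays u≢v c)
        antisym (inside _ _ c) (inside _ _ d) = T.antisym (reach-target c) (reach-target d)
        antisym (inside _ qu c) (outside _ ¬qw _) = contradiction (T.tr qu (reach-target c)) ¬qw
        antisym (outside _ ¬qu _) (top qu) = contradiction qu ¬qu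
        antisym (outside _ ¬qu _) (inside _ qw c) = contradiction (T.tr qw (reach-target c)) ¬qu
        antisym (outside _ _ d) (outside _ _ e) = T.antisym d e
        tr : ∀ {u w x} → Raised u w → Raised w x → Raised u x
        tr (top qw) (top qx) = top qx
        tr (top qw) (inside _ _ c) = top (T.tr qw (reach-target c))
        tr (top qw) (outside _ ¬qw _) = contradiction qw ¬qw
        tr (inside u≢v qu c) (top _) = contradiction refl (stays u≢v c)
        tr (inside u≢v qu c) (inside _ _ d) =
          inside u≢v qu (reach-trans c (reach-mono (T.tr (reach-target c)) d))
        tr (inside u≢v qu c) (outside _ ¬qw _) = contradiction (T.tr qu (reach-target c)) ¬qw
        tr (outside u≢v ¬qu uv) (top qx) = outside u≢v ¬qu (T.tr (above-q ¬qu qv uv) qx)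
        tr (outside u≢v ¬qu uw) (inside _ _ c) = outside u≢v ¬qu (T.tr uw (reach-target c))
        tr (outside u≢v ¬qu uw) (outside _ _ wx) = outside u≢v ¬qu (T.tr uw wx)
        chain : ∀ {u x w} → Raised u w → Raised x w → Raised u x ⊎ Raised x u
        chain (top _) (top qw) = inj₁ (top qv)
        chain (top _) (inside _ qx _) = inj₁ (top qx)
        chain (top qw) (outside x≢v ¬qx xw) = inj₂ (outside x≢v ¬qx (T.tr (above-q ¬qx qw xw) qv))
        chain (inside _ qu _) (top _) = inj₂ (top qu)
        chain (inside u≢v qu c) (inside x≢v qx d) with C c d
        ... | inj₁ p = inj₁ (inside u≢v qu p)
        ... | inj₂ p = inj₂ (inside x≢v qx p)
        chain (inside u≢v qu c) (outside x≢v ¬qx xw) =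
          inj₂ (outside x≢v ¬qx (T.tr (above-q ¬qx (T.tr qu (reach-target c)) xw) qu))
        chain (outside u≢v ¬qu uw) (top qw) = inj₁ (outside u≢v ¬qu (T.tr (above-q ¬qu qw uw) qv))
        chain (outside u≢v ¬qu uw) (inside x≢v qx d) =
          inj₁ (outside u≢v ¬qu (T.tr (above-q ¬qu (T.tr qx (reach-target d)) uw) qx))
        chain (outside u≢v ¬qu uw) (outside x≢v ¬qx xw) with T.chain uw xw
        ... | inj₁ p = inj₁ (outside u≢v ¬qu p)
        ... | inj₂ p = inj₂ (outside x≢v ¬qx p)
        adj : ∀ {u x} → Adj G u x → Raised u x ⊎ Raised x u
        adj {u} {x} e with u ≟ v | x ≟ v | desc? F q u | desc? F q x
        ... | yes refl | _ | _ | yes qx = inj₁ (top qx)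
        ... | yes refl | yes refl | _ | no ¬qx = contradiction qv ¬qx
        ... | yes refl | no x≢v | _ | no ¬qx with T.adj e
        ...   | inj₁ vx = contradiction (T.tr qv vx) ¬qx
        ...   | inj₂ xv = inj₂ (outside x≢v ¬qx xv)
        adj {u} {x} e | no _ | yes refl | yes qu | _ = inj₂ (top qu)
        adj {u} {x} e | no u≢v | yes refl | no ¬qu | _ with T.adj e
        ...   | inj₁ uv = inj₁ (outside u≢v ¬qu uv)
        ...   | inj₂ vu = contradiction (T.tr qv vu) ¬qu
        adj {u} {x} e | no u≢v | no x≢v | yes qu | yes qx
          with Tubing.adj (contracted-tubing (proj₁ g)) (isolate-adj⁺ G u≢v x≢v e)
        ...   | inj₁ p = inj₁ (inside u≢v qu p)
        ...   | inj₂ p = inj₂ (inside x≢v qx p)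
        adj {u} {x} e | no u≢v | no x≢v | yes qu | no ¬qx with T.adj e
        ...   | inj₁ ux = contradiction (T.tr qu ux) ¬qx
        ...   | inj₂ xu = inj₂ (outside x≢v ¬qx xu)
        adj {u} {x} e | no u≢v | no x≢v | no ¬qu | yes qx with T.adj e
        ...   | inj₁ ux = inj₁ (outside u≢v ¬qu ux)
        ...   | inj₂ xu = contradiction (T.tr qx xu) ¬qu
        adj {u} {x} e | no u≢v | no x≢v | no ¬qu | no ¬qx with T.adj e
        ...   | inj₁ ux = inj₁ (outside u≢v ¬qu ux)
        ...   | inj₂ xu = inj₂ (outside x≢v ¬qx xu)
        conn : ∀ {u w} → Raised u w → Reach G (Raised u) u w
        conn (top qw) = reach-mono top (reach-trans (reach-sym (T.conn qv)) (T.conn qw))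
        conn (inside u≢v qu c) = reach-map (isolate-≤ G) (inside u≢v qu) (reach-self c)
        conn (outside u≢v ¬qu d) = reach-mono (outside u≢v ¬qu) (T.conn d)

      raised? : Decidable Raised
      raised? u w with u ≟ v | desc? F q u
      ... | yes refl | _ = map′ top (λ { (top d) → d ; (inside p _ _) → contradiction refl p
                                       ; (outside p _ _) → contradiction refl p }) (desc? F q w)
      ... | no u≢v | yes qu = map′ (inside u≢v qu)
              (λ { (top _) → contradiction refl u≢v ; (inside _ _ c) → c
                 ; (outside _ ¬qu _) → contradiction qu ¬qu }) (contracted? F u w)
      ... | no u≢v | no ¬qu = map′ (outside u≢v ¬qu)
              (λ { (top _) → contradiction refl u≢v ; (inside _ qu _) → contradiction qu ¬qu
                 ; (outside _ _ d) → d }) (desc? F u w)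

      raise : ∃ λ F' → Good G F' × (∀ u → Desc F' u ≐ Raised u)
      raise = Realise.realise raised? , realise-good raised? raised-tubing , Realise.realise-≐ raised? raised-tubing

      raise-top : Desc (proj₁ raise) v ≐ Desc F q
      raise-top = (λ d → strip (proj₁ (proj₂ (proj₂ raise) v) d)) , λ d → proj₂ (proj₂ (proj₂ raise) v) (top d)
        where
        strip : ∀ {w} → Raised v w → A q w
        strip (top d)         = d
        strip (inside p _ _)  = contradiction refl p
        strip (outside p _ _) = contradiction refl p

  -- Raising c by one level. A vertex below p, other than p and c, cannot have c in its subtree,
  -- since it would then be above p; so only the subtree of p is split.
  rotate : ∀ {G F p c} → Good G F → Par (Desc F) p c →
           ∃ λ F' → Good G F' × AgreeOff p c F F' × Desc F' c ≐ Desc F p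
  rotate {G} {F} {p} {c} g (pc , p≢c , m) = proj₁ raise , proj₁ (proj₂ raise) , agree , raise-top
    where
    open Contract G c
    open Raise g pc
    agree : AgreeOff p c F (proj₁ raise)
    agree u u≢p u≢c = (λ d → proj₂ (proj₂ (proj₂ raise) u) (to d)) , λ d → from (proj₁ (proj₂ (proj₂ raise) u) d)
      where
      to : ∀ {w} → Desc F u w → Raised u w
      to d with desc? F p u
      ... | no ¬pu = outside u≢c ¬pu d
      ... | yes pu = inside u≢c pu (reach-avoid G
              (λ uc → u≢p (Tubing.antisym (proj₁ g) (m u uc u≢c) pu)) (Tubing.conn (proj₁ g) d))
      from : ∀ {w} → Raised u w → Desc F u w
      from (top _)         = contradiction refl u≢c
      from (inside _ _ r)  = reach-target r
      from (outside _ _ d) = d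

-- Consecutive elements of a list

module _ {X : Set} where

  data Consec : List X → X → X → Set where
    here  : ∀ {a b xs} → Consec (a ∷ b ∷ xs) a b
    there : ∀ {x a b xs} → Consec xs a b → Consec (x ∷ xs) a b

  consec-∈ˡ : ∀ {xs a b} → Consec xs a b → a ∈ xs
  consec-∈ˡ here      = here refl
  consec-∈ˡ (there c) = there (consec-∈ˡ c)

  consec-∈ʳ : ∀ {x xs a b} → Consec (x ∷ xs) a b → b ∈ xs
  consec-∈ʳ here                = here refl
  consec-∈ʳ (there {xs = _ ∷ _} c) = there (consec-∈ʳ c)

  head-∉ : ∀ {x : X} {xs} → Unique (x ∷ xs) → ¬ x ∈ xs
  head-∉ (p ∷ _) x∈xs = All.lookup p x∈xs refl

  unique-tail : ∀ {x : X} {xs} → Unique (x ∷ xs) → Unique xs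
  unique-tail (_ ∷ u) = u

  consec-functional : ∀ {xs a b b'} → Unique xs → Consec xs a b → Consec xs a b' → b ≡ b'
  consec-functional u here      here       = refl
  consec-functional u here      (there c)  = contradiction (consec-∈ˡ c) (head-∉ u)
  consec-functional u (there c) here       = contradiction (consec-∈ˡ c) (head-∉ u)
  consec-functional u (there c) (there c') = consec-functional (unique-tail u) c c'

  consec-injective : ∀ {xs a a' b} → Unique xs → Consec xs a b → Consec xs a' b → a ≡ a'
  consec-injective u here      here       = refl
  consec-injective u here      (there c)  = contradiction (consec-∈ʳ c) (head-∉ (unique-tail u))
  consec-injective u (there c) here       = contradiction (consec-∈ʳ c) (head-∉ (unique-tail u))
  consec-injective u (there c) (there c') = consec-injective (unique-tail u) c c'

  consec-mid : ∀ ps {x y s} → Consec (ps ++ x ∷ y ∷ s) x y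
  consec-mid []       = here
  consec-mid (_ ∷ ps) = there (consec-mid ps)

  unique-disjoint : ∀ ps {s} {a : X} → Unique (ps ++ s) → a ∈ ps → ¬ a ∈ s
  unique-disjoint (p ∷ ps) u (here refl) a∈s = head-∉ u (∈-++⁺ʳ ps a∈s)
  unique-disjoint (p ∷ ps) u (there a∈ps) a∈s = unique-disjoint ps (unique-tail u) a∈ps a∈s

  -- Together with `prefix-previous`: moving between consecutive entries, a prefix can be left only
  -- through the entry x that follows it. This confines fibres to prefixes of the run.
  prefix-next : ∀ ps {x s a b} → Unique (ps ++ x ∷ s) → Consec (ps ++ x ∷ s) a b → a ∈ ps → b ∈ ps ⊎ b ≡ x
  prefix-next (p ∷ [])     u here      _            = inj₂ refl
  prefix-next (p ∷ q ∷ ps) u here      _            = inj₁ (there (here refl))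
  prefix-next (p ∷ ps)     u (there c) (here refl)  = contradiction (consec-∈ˡ c) (head-∉ u)
  prefix-next (p ∷ ps)     u (there c) (there a∈ps) with prefix-next ps (unique-tail u) c a∈ps
  ... | inj₁ b∈ps = inj₁ (there b∈ps)
  ... | inj₂ b≡x  = inj₂ b≡x

  prefix-previous : ∀ ps {x s a b} → Unique (ps ++ x ∷ s) → Consec (ps ++ x ∷ s) a b → b ∈ ps → a ∈ ps
  prefix-previous (p ∷ [])     u c           (here refl)  = contradiction (consec-∈ʳ c) (head-∉ u)
  prefix-previous (p ∷ q ∷ ps) u c           (here refl)  = contradiction (consec-∈ʳ c) (head-∉ u)
  prefix-previous (p ∷ q ∷ ps) u here        _            = here refl
  prefix-previous (p ∷ q ∷ ps) u (there c)   (there b∈ps) = there (prefix-previous (q ∷ ps) (unique-tail u) c b∈ps)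

-- Labelled rotations and the order in which a run visits forests

module _ {n : ℕ} where

  record Edge (G : Graph n) (i j : Fin n) (F F' : Forest n) : Set where
    constructor edge
    field
      i<j   : i <ᶠ j
      good  : Good G F
      good′ : Good G F'
      agree : AgreeOff i j F F'
      F≢F'  : F ≢ F'

  edge-sym : ∀ {G i j F F'} → Edge G i j F F' → Edge G i j F' F
  edge-sym (edge lt g g' ag ne) = edge lt g' g (agreeOff-sym ag) (≢-sym ne)

  edge-par : ∀ {G i j F F'} → Edge G i j F F' → Flipped {G = G} i j F F' ⊎ Flipped {G = G} j i F F'
  edge-par (edge _ g g' ag ne) = agreeOff-cases g g' ag ne

  -- Which of i and j is the parent is read off from `F`, and the result must have the opposite
  -- order.
  edge-deterministic : ∀ {G i j F F' F''} → Edge G i j F F' → Edge G i j F F'' → F' ≡ F''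
  edge-deterministic {G} e@(edge _ g g' ag _) e'@(edge _ _ g'' ag' _) with edge-par e | edge-par e'
  ... | inj₁ (_ , cp , _) | inj₁ (_ , cp' , _) = flipped-unique g g' g'' ag ag' cp cp'
  ... | inj₂ (_ , cp , _) | inj₂ (_ , cp' , _) =
    flipped-unique g g' g'' (agreeOff-swap ag) (agreeOff-swap ag') cp cp'
  ... | inj₁ (p , _) | inj₂ ((q , _) , _) = contradiction q (par-asym g p)
  ... | inj₂ (p , _) | inj₁ ((q , _) , _) = contradiction q (par-asym g p)

  -- With two distinct labels only the subtree of v could change, and then nothing changes.
  edge-label : ∀ {G a b v F F'} → Edge G a v F F' → Edge G b v F F' → a ≡ b
  edge-label {a = a} {b} {v} {F} {F'} (edge _ g g' ag ne) (edge _ _ _ ag' _) with a ≟ b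
  ... | yes a≡b = a≡b
  ... | no a≢b  = contradiction (agreeOff-one {i = v} g g' off) ne
    where
    off : AgreeOff v v F F'
    off u u≢v _ with u ≟ a
    ... | yes refl = ag' u a≢b u≢v
    ... | no u≢a   = ag u u≢a u≢v

  abstract
    rotation : ∀ {G : Graph n} {F : Forest n} {p c} → Good G F → Par (Desc F) p c →
               ∃ λ (F' : Forest n) → Good G F' × AgreeOff p c F F' × F ≢ F' × Desc F' c p
    rotation g par with rotate g par
    ... | F' , g' , ag , eq = F' , g' , ag , (λ { refl → par-asym g par (proj₂ eq self) }) , proj₂ eq self

  -- Later entries are exactly the still unvisited forests. The bound on their labels is strict
  -- because a tie for the largest vertex would have stopped the run.
  data Greedy (G : Graph n) : List (Forest n) → Set where
    [-]  : ∀ {x} → Greedy G (x ∷ [])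
    _∷⟨_⟩_ : ∀ {x y r i j} → Edge G i j x y →
           (∀ {z i' j'} → z ∈ r → Edge G i' j' x z → j' <ᶠ j) →
           Greedy G (y ∷ r) → Greedy G (x ∷ y ∷ r)

  -- Successful runs of the algorithm: a forest is unvisited exactly when it occurs later in the list.
  record Exhaustive (G : Graph n) : Set where
    field
      first    : Forest n
      rest     : List (Forest n)
      greedy   : Greedy G (first ∷ rest)
      unique   : Unique (first ∷ rest)
      good     : ∀ {F} → F ∈ first ∷ rest → Good G F
      complete : ∀ {F} → Good G F → F ∈ first ∷ rest

  -- Rotations of a vertex v above which every vertex is isolated

  module Top (G : Graph n) (v : Fin n) (isolated-above : ∀ {u w} → Adj G u w → u ≤ᶠ v) where

    -- The two vertices are joined by a walk with at least one edge, so neither is isolated.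
    desc-≤ : ∀ {F u w} → Good G F → Desc F u w → u ≢ w → u ≤ᶠ v × w ≤ᶠ v
    desc-≤ g d u≢w with Tubing.conn (proj₁ g) d
    ... | here _ = contradiction refl u≢w
    ... | r@(step _ e _) with reach-sym r
    ...   | here _      = contradiction refl u≢w
    ...   | step _ e' _ = isolated-above e , isolated-above e'

    edge-≤ : ∀ {i j F F'} → Edge G i j F F' → j ≤ᶠ v
    edge-≤ e with edge-par e
    ... | inj₁ ((d , ne , _) , _) = proj₂ (desc-≤ (Edge.good e) d ne)
    ... | inj₂ ((d , ne , _) , _) = proj₁ (desc-≤ (Edge.good e) d ne)

    VEdge : Forest n → Forest n → Set
    VEdge F F' = ∃ λ i → Edge G i v F F'

    ≤∧≢⇒<ᶠ : ∀ {u w : Fin n} → u ≤ᶠ w → u ≢ w → u <ᶠ w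
    ≤∧≢⇒<ᶠ le ne = ≤∧≢⇒< le (ne ∘ toℕ-injective)

    -- A tree neighbour of v is not isolated, hence smaller than v. So every tree edge at v, here
    -- and in `child-edge`, gives a rotation labelled by v.
    parent-edge : ∀ {F t} → Good G F → Par (Desc F) t v → ∃ λ F' → Edge G t v F F' × Desc F' v t
    parent-edge g par@(d , ne , _) with rotation g par
    ... | F' , g' , ag , F≢F' , vt =
      F' , edge (≤∧≢⇒<ᶠ (proj₁ (desc-≤ g d ne)) ne) g g' ag F≢F' , vt

    child-edge : ∀ {F c} → Good G F → Par (Desc F) v c → ∃ λ F' → Edge G c v F F'
    child-edge g par@(d , ne , _) with rotation g par
    ... | F' , g' , ag , F≢F' , _ =
      F' , edge (≤∧≢⇒<ᶠ (proj₂ (desc-≤ g d ne)) (≢-sym ne)) g g' (agreeOff-swap ag) F≢F'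

    Degree≤2 : Set
    Degree≤2 = ∀ {F F₁ F₂ F₃} → VEdge F F₁ → VEdge F F₂ → VEdge F F₃ → F₁ ≡ F₂ ⊎ F₁ ≡ F₃ ⊎ F₂ ≡ F₃

    module _ (deg : Degree≤2) where

      -- The parent of v and the children of v above x and y give three v-neighbours. Two of them
      -- coincide, and by `edge-label` these can only belong to the children, so x and y lie below
      -- one child.
      no-branching : ∀ {F t x y} → Good G F → Desc F t v → t ≢ v →
        Desc F v x → v ≢ x → Desc F v y → v ≢ y → Reach G (λ z → Desc F v z × z ≢ v) x y
      no-branching {F} {t} {x} {y} g tv t≢v vx v≢x vy v≢y
        with par-exists (proj₁ g) (desc? F) tv t≢v | child-exists (proj₁ g) (desc? F) vx v≢x
           | child-exists (proj₁ g) (desc? F) vy v≢y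
      ... | p , ppar | c , cpar@(vc , v≢c , _) , cx | d , dpar , dy
        with parent-edge g ppar | child-edge g cpar | child-edge g dpar
      ... | _ , e₁ , _ | _ , e₂ | _ , e₃ with deg (_ , e₁) (_ , e₂) (_ , e₃)
      ... | inj₁ refl with refl ← edge-label e₁ e₂ = contradiction (proj₁ cpar) (par-asym g ppar)
      ... | inj₂ (inj₁ refl) with refl ← edge-label e₁ e₃ = contradiction (proj₁ dpar) (par-asym g ppar)
      ... | inj₂ (inj₂ refl) with refl ← edge-label e₂ e₃ =
        reach-mono (λ {z} cz → T.tr vc cz , λ { refl → v≢c (T.antisym vc cz) })
          (reach-trans (reach-sym (T.conn cx)) (T.conn dy))
        where module T = Tubing (proj₁ g)

      -- After v is raised to the place of q, its subtree is that of q and t is still a proper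
      -- ancestor, so `no-branching` applies.
      no-separation : ∀ {F q t x y} → Good G F → Desc F q v → Desc F t q → t ≢ q →
        Desc F q x → v ≢ x → Desc F q y → v ≢ y → Reach G (λ z → Desc F q z × z ≢ v) x y
      no-separation {F} {q} {t} g qv tq t≢q qx v≢x qy v≢y =
        reach-mono (λ (d , ne) → proj₁ raise-top d , ne)
          (no-branching (proj₁ (proj₂ raise)) (proj₂ (proj₂ (proj₂ raise) t) (outside t≢v ¬qt (T.tr tq qv))) t≢v
            (proj₂ raise-top qx) v≢x (proj₂ raise-top qy) v≢y)
        where
        open Contract G v
        open Raise g qv
        module T = Tubing (proj₁ g)
        ¬qt : ¬ Desc F q t
        ¬qt qt = t≢q (T.antisym tq qt)
        t≢v : t ≢ v
        t≢v refl = ¬qt qv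

    open Contract G v

    vedge-contract : ∀ {F F'} → VEdge F F' → contract F ≡ contract F'
    vedge-contract (_ , edge _ g g' ag _) = contract-≡ g g' ag

    module _ (Q : Forest n → Set) (closed : ∀ {F F'} → VEdge F F' → Q F → Q F') where

      -- Rotating v with its parent until v is a root. The list `R` contains the proper ancestors of
      -- v and loses the old parent in each round. Connectivity is expressed by transporting any
      -- invariant `Q` along the way and back.
      climb : ∀ k (R : List (Fin n)) → length R ≤ k → ∀ {F} → Good G F →
              (∀ {x} → Desc F x v → x ≢ v → x ∈ R) →
              ∃ λ F' → Good G F' × contract F ≡ contract F' × (∀ u → Desc F' u v → u ≡ v) ×
                       (Q F → Q F') × (Q F' → Q F)
      climb k R le {F} g anc with any? (λ p → par? (desc? F) p v)
      ... | no none = F , g , refl , (λ u d → decidable-stable (u ≟ v)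
                        λ ne → none (par-exists (proj₁ g) (desc? F) d ne)) , id , id
      ... | yes (p , par@(pv , p≢v , _)) with parent-edge g par
      ...   | F₁ , e , vp = continue k le
        where
        shorter : length (filter (λ x → ¬? (x ≟ p)) R) < length R
        shorter = filter-notAll (λ x → ¬? (x ≟ p)) R
          (Any.map (λ eq ne → ne (sym eq)) (anc pv p≢v))
        anc₁ : ∀ {x} → Desc F₁ x v → x ≢ v → x ∈ filter (λ x → ¬? (x ≟ p)) R
        anc₁ {x} d x≢v = ∈-filter⁺ (λ x → ¬? (x ≟ p))
          (anc (proj₂ (Edge.agree e x x≢p x≢v) d) x≢v) x≢p
          where
          x≢p : x ≢ p
          x≢p refl = p≢v (Tubing.antisym (proj₁ (Edge.good′ e)) d vp)
        continue : ∀ k → length R ≤ k → ∃ λ F' → Good G F' × contract F ≡ contract F' ×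
                   (∀ u → Desc F' u v → u ≡ v) × (Q F → Q F') × (Q F' → Q F)
        continue zero    le = contradiction (≤-trans shorter le) λ ()
        continue (suc k) le
          with climb k (filter (λ x → ¬? (x ≟ p)) R) (s≤s⁻¹ (≤-trans shorter le)) (Edge.good′ e) anc₁
        ... | F' , g' , eq , top , to , from =
          F' , g' , trans (vedge-contract (p , e)) eq , top , to ∘ closed (p , e) , closed (p , edge-sym e) ∘ from

      -- Both forests climb to one with v as a root; contraction does not change on the way, so
      -- `contract-root-injective` makes the two end points equal.
      fibre-connected : ∀ {F F'} → Good G F → Good G F' → contract F ≡ contract F' → Q F → Q F'
      fibre-connected {F} {F'} g g' eq q
        with climb _ (allFin n) ≤-refl g (λ _ _ → ∈-allFin _)
           | climb _ (allFin n) ≤-refl g' (λ _ _ → ∈-allFin _)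
      ... | H , h , e , top , to , _ | H' , h' , e' , top' , _ , from
        with refl ← contract-root-injective h h' top top' (trans (sym e) (trans eq e')) = from (to q)

    edge-contract : ∀ {i j F F'} → Edge G i j F F' → contract F ≢ contract F' →
                    Edge (isolate v G) i j (contract F) (contract F')
    edge-contract (edge lt g g' ag _) ne =
      edge lt (contract-good g) (contract-good g') (contract-agreeOff g g' ag) ne

    Degree≤1 : Forest n → Set
    Degree≤1 F = ∀ {F₁ F₂} → VEdge F F₁ → VEdge F F₂ → F₁ ≡ F₂

    abstract
      -- A vertex q strictly between p and c is the only obstruction. If q = v, its parent and a
      -- child give two distinct v-neighbours. If q avoids v in its subtree, it survives above c
      -- after the deletion. Otherwise q loses c only if v separates them, which `no-separation`
      -- forbids.
      par-lift : Degree≤2 → ∀ {F p c} → Good G F → Degree≤1 F → Par (Desc (contract F)) p c → Par (Desc F) p c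
      par-lift deg {F} {p} {c} g deg₁ (pc' , p≢c , m) = pc , p≢c , minimal
        where
        module T = Tubing (proj₁ g)
        pc : Desc F p c
        pc = contract-⊆ g pc'
        c≢v : c ≢ v
        c≢v refl = p≢c (isolated-desc (contract-good g) pc')
        minimal : ∀ q → Desc F q c → q ≢ c → Desc F q p
        minimal q qc q≢c with T.chain qc pc | desc? (contract F) q c | q ≟ p
        ... | inj₁ qp | _      | _        = qp
        ... | inj₂ _  | yes d  | _        = contract-⊆ g (m q d q≢c)
        ... | inj₂ _  | no _   | yes refl = self
        ... | inj₂ pq | no ¬d  | no q≢p with q ≟ v
        ...   | yes refl
          with par-exists (proj₁ g) (desc? F) pq (≢-sym q≢p) | child-exists (proj₁ g) (desc? F) qc q≢c
        ...     | s , spar | d , dpar , _ with parent-edge g spar | child-edge g dpar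
        ...       | _ , e₁ , _ | _ , e₂ with refl ← deg₁ (_ , e₁) (_ , e₂)
                                         with refl ← edge-label e₁ e₂ =
          contradiction (proj₁ dpar) (par-asym g spar)
        minimal q qc q≢c | inj₂ pq | no ¬d | no q≢p | no q≢v with desc? F q v
        ... | no ¬qv = contradiction (contract-avoid g ¬qv qc) ¬d
        ... | yes qv = contradiction
                (proj₂ (contract-≐ g q) (reach-mono proj₁ (reach-avoid G (λ (_ , ne) → ne refl)
                  (no-separation deg g qv pq (≢-sym q≢p) self (≢-sym q≢v) qc (≢-sym c≢v))))) ¬d

    abstract
      -- The contraction of the lifted rotation and `T` both agree with `contract F` off p and c,
      -- and p is above c in neither, so they are equal.
      flip-lift : Degree≤2 → ∀ {F T p c} → Good G F → Degree≤1 F → Good (isolate v G) T →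
                  AgreeOff p c (contract F) T → Flipped {G = isolate v G} p c (contract F) T →
                  ∃ λ F' → Good G F' × AgreeOff p c F F' × F ≢ F' × contract F' ≡ T
      flip-lift deg {F} {T} {p} {c} g deg₁ gT ag (par , par') with rotation g (par-lift deg g deg₁ par)
      ... | F' , g' , ag' , F≢F' , cp = F' , g' , ag' , F≢F' ,
        agreeOff-≡ (contract-good g') gT
          (agreeOff-swap (agreeOff-trans (agreeOff-sym (contract-agreeOff g g' ag')) ag))
          (λ d → contradiction (Tubing.antisym (proj₁ g') (contract-⊆ g' d) cp) (proj₁ (proj₂ par)))
          (λ d → contradiction d (par-asym gT par'))

    edge-lift : Degree≤2 → ∀ {F T i j} → Good G F → Degree≤1 F → Edge (isolate v G) i j (contract F) T →
                ∃ λ F' → Edge G i j F F' × contract F' ≡ T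
    edge-lift deg {F} {T} {i} {j} g deg₁ e@(edge lt _ gT ag _) with edge-par e
    ... | inj₁ fl with flip-lift deg g deg₁ gT ag fl
    ...   | F' , g' , ag' , ne , eq = F' , edge lt g g' ag' ne , eq
    edge-lift deg {F} {T} {i} {j} g deg₁ e@(edge lt _ gT ag _)
        | inj₂ fl with flip-lift deg g deg₁ gT (agreeOff-swap ag) fl
    ...   | F' , g' , ag' , ne , eq = F' , edge lt g g' (agreeOff-swap ag') ne , eq

    -- If the earlier of the two forests were followed by a third, that step would have a label at
    -- most v by `edge-≤`, whereas the other forest, occurring later, demands a label above v.
    vedge-consec : ∀ {xs F F'} → Greedy G xs → VEdge F F' → F ∈ xs → F' ∈ xs → Consec xs F F' ⊎ Consec xs F' F
    vedge-consec gr (_ , e) (here refl) (here refl) = contradiction refl (Edge.F≢F' e)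
    vedge-consec (_ ∷⟨ _ ⟩ _) _ (here refl) (there (here refl)) = inj₁ here
    vedge-consec (e' ∷⟨ later ⟩ _) (_ , e) (here refl) (there (there F'∈)) =
      contradiction (edge-≤ e') (<⇒≱ (later F'∈ e))
    vedge-consec (_ ∷⟨ _ ⟩ _) _ (there (here refl)) (here refl) = inj₂ here
    vedge-consec (e' ∷⟨ later ⟩ _) (_ , e) (there (there F∈)) (here refl) =
      contradiction (edge-≤ e') (<⇒≱ (later F∈ (edge-sym e)))
    vedge-consec (_ ∷⟨ _ ⟩ gr) e (there F∈) (there F'∈) with vedge-consec gr e F∈ F'∈
    ... | inj₁ c = inj₁ (there c)
    ... | inj₂ c = inj₂ (there c)

    -- The sequence of fibres as a run for the smaller graph

    module Quotient (ex : Exhaustive G) where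
      open Exhaustive ex

      xs : List (Forest n)
      xs = first ∷ rest

      consec : ∀ {F F'} → VEdge F F' → Consec xs F F' ⊎ Consec xs F' F
      consec e = vedge-consec greedy e (complete (Edge.good (proj₂ e))) (complete (Edge.good′ (proj₂ e)))

      degree≤2 : Degree≤2
      degree≤2 e₁ e₂ e₃ with consec e₁ | consec e₂ | consec e₃
      ... | inj₁ c | inj₁ d | _      = inj₁ (consec-functional unique c d)
      ... | inj₂ c | inj₂ d | _      = inj₁ (consec-injective unique c d)
      ... | inj₁ c | inj₂ _ | inj₁ d = inj₂ (inj₁ (consec-functional unique c d))
      ... | inj₁ _ | inj₂ c | inj₂ d = inj₂ (inj₂ (consec-injective unique c d))
      ... | inj₂ _ | inj₁ c | inj₁ d = inj₂ (inj₂ (consec-functional unique c d))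
      ... | inj₂ c | inj₁ _ | inj₂ d = inj₂ (inj₁ (consec-injective unique c d))

      -- Lying in `ps` and outside the fibre of x is invariant under rotations of v, since the only
      -- exit from the prefix leads to x. The fibre is connected, so it lies in `ps` as a whole.
      fibre-in-prefix : ∀ ps {x s} → xs ≡ ps ++ x ∷ s → ∀ {F F'} → F ∈ ps → contract F ≢ contract x →
                        Good G F' → contract F ≡ contract F' → F' ∈ ps
      fibre-in-prefix ps {x} {s} split {F} {F'} F∈ ne g' eq =
        proj₁ (fibre-connected Q closed (good (subst (F ∈_) (sym split) (∈-++⁺ˡ F∈))) g' eq (F∈ , ne))
        where
        Q : Forest n → Set
        Q F = F ∈ ps × contract F ≢ contract x
        u : Unique (ps ++ x ∷ s)
        u = subst Unique split unique
        closed : ∀ {F F'} → VEdge F F' → Q F → Q F'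
        closed {F} {F'} e (F∈ , ne) = member (consec e) , λ eq → ne (trans (vedge-contract e) eq)
          where
          member : Consec xs F F' ⊎ Consec xs F' F → F' ∈ ps
          member (inj₂ c) = prefix-previous ps u (subst (λ l → Consec l F' F) split c) F∈
          member (inj₁ c) with prefix-next ps u (subst (λ l → Consec l F F') split c) F∈
          ... | inj₁ F'∈  = F'∈
          ... | inj₂ refl = contradiction (vedge-contract e) ne

      -- The prefix `ps` of forests already passed is carried along to show that a fibre once left
      -- never returns, and that no rotation lifts back into the past.
      build : ∀ ps x r → xs ≡ ps ++ x ∷ r → Greedy G (x ∷ r) → ∃ λ ys →
              Greedy (isolate v G) (contract x ∷ ys) × Unique (contract x ∷ ys) ×
              (∀ {T} → T ∈ contract x ∷ ys → ∃ λ F → F ∈ x ∷ r × contract F ≡ T) ×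
              (∀ {F} → F ∈ x ∷ r → contract F ∈ contract x ∷ ys)
      build ps x [] _ _ = [] , [-] , All.[] ∷ [] ,
        (λ { (here refl) → x , here refl , refl }) , λ { (here refl) → here refl }
      build ps x (y ∷ r) split (e ∷⟨ later ⟩ gr)
        with build (ps ++ x ∷ []) y r (trans split (sym (++-assoc ps (x ∷ []) (y ∷ r)))) gr
           | forest-≟ (contract x) (contract y)
      ... | ys , gr' , u' , from , to | yes eq rewrite eq = ys , gr' , u' ,
        (λ T∈ → let F , F∈ , e = from T∈ in F , there F∈ , e) ,
        λ { (here refl) → here eq ; (there F∈) → to F∈ }
      ... | ys , gr' , u' , from , to | no ne = contract y ∷ ys ,
        (edge-contract e ne ∷⟨ later' ⟩ gr') ,
        All.tabulate fresh ∷ u' ,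
        (λ { (here refl) → x , here refl , refl ; (there T∈) → let F , F∈ , e = from T∈ in F , there F∈ , e }) ,
        λ { (here refl) → here refl ; (there F∈) → there (to F∈) }
        where
        split' : xs ≡ (ps ++ x ∷ []) ++ y ∷ r
        split' = trans split (sym (++-assoc ps (x ∷ []) (y ∷ r)))
        u : Unique (ps ++ x ∷ y ∷ r)
        u = subst Unique split unique
        ∈-xs : ∀ {F} → F ∈ ps ++ x ∷ y ∷ r → Good G F
        ∈-xs F∈ = good (subst (_ ∈_) (sym split) F∈)
        -- The next forest y is in another fibre, so the fibre of x is already complete.
        fresh : ∀ {T} → T ∈ contract y ∷ ys → contract x ≢ T
        fresh T∈ refl with from T∈
        ... | F , F∈ , eq = unique-disjoint (ps ++ x ∷ []) (subst Unique split' unique)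
          (fibre-in-prefix (ps ++ x ∷ []) split' (∈-++⁺ʳ ps (here refl)) ne
            (∈-xs (∈-++⁺ʳ ps (there F∈))) (sym eq)) F∈
        is-y : ∀ {F} → Consec xs x F → F ≡ y
        is-y c = consec-functional u (subst (λ l → Consec l x _) split c) (consec-mid ps)
        -- The successor of x lies in another fibre, so a v-neighbour of x can only be its
        -- predecessor.
        deg₁ : Degree≤1 x
        deg₁ e₁ e₂ with consec e₁ | consec e₂
        ... | inj₂ c | inj₂ d = consec-injective unique c d
        ... | inj₁ c | _ = contradiction (trans (vedge-contract e₁) (cong contract (is-y c))) ne
        ... | inj₂ _ | inj₁ c = contradiction (trans (vedge-contract e₂) (cong contract (is-y c))) ne
        -- The lifted neighbour occurs somewhere in the run. As y it would repeat the fibre of y;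
        -- before x its whole fibre would precede x; so it comes after y, where the original bound
        -- holds.
        later' : ∀ {T i' j'} → T ∈ ys → Edge (isolate v G) i' j' (contract x) T → j' <ᶠ _
        later' {T} T∈ e'' with edge-lift degree≤2 (Edge.good e) deg₁ e'' | from (there T∈)
        ... | F' , lifted , eq | F , F∈ , eqF with ∈-++⁻ ps (subst (F' ∈_) split (complete (Edge.good′ lifted)))
        ...   | inj₂ (here refl) = contradiction refl (Edge.F≢F' lifted)
        ...   | inj₂ (there (here refl)) = contradiction (subst (_∈ ys) (sym eq) T∈) (head-∉ u')
        ...   | inj₂ (there (there F'∈)) = later F'∈ lifted
        ...   | inj₁ F'∈ = contradiction (there F∈) (unique-disjoint ps u
                  (fibre-in-prefix ps split F'∈ (λ eq' → Edge.F≢F' e'' (trans (sym eq') eq))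
                    (∈-xs (∈-++⁺ʳ ps (there F∈))) (trans eq (sym eqF))))

      quotient : Exhaustive (isolate v G)
      quotient with build [] first rest refl greedy
      ... | ys , gr , u , from , to = record
        { first    = contract first
        ; rest     = ys
        ; greedy   = gr
        ; unique   = u
        ; good     = λ T∈ → let F , F∈ , eq = from T∈ in subst (Good (isolate v G)) eq (contract-good (good F∈))
        ; complete = λ g → let F , gF , eq = contract-surjective g in
                           subst (_∈ _) eq (to (complete gF))
        }

-- Comparison with Rot and IsElimForest

module _ {n : ℕ} where

  reach-exit : {G : Graph n} {P Q : Fin n → Set} → (∀ x → Dec (Q x)) →
               ∀ {u v} → Reach G P u v → ¬ Q u → Q v →
               ∃ λ x → ∃ λ y → P x × ¬ Q x × Adj G x y × Q y
  reach-exit Q? (here _) ¬q q = contradiction q ¬q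
  reach-exit Q? (step {u} {w} p e r) ¬q q with Q? w
  ... | yes qw = u , w , p , ¬q , e , qw
  ... | no ¬qw = reach-exit Q? r ¬qw q

  -- The edge by which a walk inside the subtree of p enters that of v starts at a proper ancestor
  -- of v, and within the subtree of p that is p itself.
  par-adj : ∀ {G : Graph n} {F : Forest n} {p v} → Good G F → Par (Desc F) p v → ∃ λ w → Desc F v w × Adj G p w
  par-adj {G} {F} {p} {v} g par@(pv , p≢v , m)
    with reach-exit (desc? F v) (Tubing.conn (proj₁ g) pv) (par-asym g par) self
  ... | x , y , px , ¬vx , e , vy with x≡p
    where
    module T = Tubing (proj₁ g)
    x≡p : x ≡ p
    x≡p with T.adj e
    ... | inj₂ yx = contradiction (T.tr vy yx) ¬vx
    ... | inj₁ xy with T.chain xy vy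
    ...   | inj₂ vx = contradiction vx ¬vx
    ...   | inj₁ xv = T.antisym (m x xv λ { refl → ¬vx self }) px
  ... | refl = y , vy , e

  module _ {G : Graph n} {F F' : Forest n} {p c : Fin n} (g : Good G F) (g' : Good G F')
    (ag : AgreeOff p c F F') (par : Par (Desc F) p c) (par' : Par (Desc F') c p) where
    private module T = Tubing (proj₁ g)

    rotated-parent : ∀ {q} → Par (Desc F) q p → Par (Desc F') q c
    rotated-parent {q} (qp , q≢p , m) = proj₁ (ag q q≢p q≢c) (T.tr qp (proj₁ par)) , q≢c , minimal
      where
      q≢c : q ≢ c
      q≢c refl = par-asym g par qp
      minimal : ∀ s → Desc F' s c → s ≢ c → Desc F' s q
      minimal s sc s≢c = proj₁ (ag s s≢p s≢c) (m s (proj₂ (proj₂ par) s (proj₂ (ag s s≢p s≢c) sc) s≢c) s≢p)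
        where
        s≢p : s ≢ p
        s≢p refl = par-asym g' par' sc

  module _ {G : Graph n} {F F' : Forest n} {p c : Fin n} (g : Good G F) (g' : Good G F')
    (ag : AgreeOff p c F F') (par : Par (Desc F) p c) (top : Desc F' c ≐ Desc F p) where
    private
      module T  = Tubing (proj₁ g)
      module T' = Tubing (proj₁ g')

      p≢c : p ≢ c
      p≢c = proj₁ (proj₂ par)

      par' : Par (Desc F') c p
      par' = agreeOff-flip g' g (agreeOff-sym (agreeOff-swap ag)) (proj₂ top self) (proj₁ par) (≢-sym p≢c)

      SameComp : Fin n → Set
      SameComp v = ∀ w → Desc F v w → Reach G (λ x → Desc F p x × x ≢ c) p w

      p-⊆ : Desc F' p ⊆ Desc F p
      p-⊆ d = proj₁ top (T'.tr (proj₁ par') d)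

      above-c : ∀ {s v} → Par (Desc F) c v → s ≢ p → s ≢ c → Desc F' s v → s ≢ v → Desc F s c
      above-c (_ , _ , m) s≢p s≢c d s≢v = m _ (proj₂ (ag _ s≢p s≢c) d) s≢v

      -- A walk in the old subtree of p that avoids c meets no proper ancestor of p in `F'`, so
      -- `tube⁺` puts v below p.
      joins-p : ∀ {v} → Par (Desc F) c v → SameComp v → Par (Desc F') p v
      joins-p {v} cpar@(cv , c≢v , m) same = pv , p≢v , minimal
        where
        p≢v : p ≢ v
        p≢v refl = par-asym g par cv
        avoids : ∀ {x} → Desc F p x × x ≢ c → Desc F' x p → x ≡ p
        avoids {x} (px , x≢c) xp with x ≟ p
        ... | yes eq  = eq
        ... | no x≢p = T.antisym (proj₂ (ag x x≢p x≢c) xp) px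
        pv : Desc F' p v
        pv = T'.tube⁺ (reach-mono avoids (same v self))
        minimal : ∀ s → Desc F' s v → s ≢ v → Desc F' s p
        minimal s sv s≢v with s ≟ p | s ≟ c
        ... | yes refl | _        = self
        ... | no _     | yes refl = proj₁ par'
        ... | no s≢p   | no s≢c   =
          proj₁ (ag s s≢p s≢c) (proj₂ (proj₂ par) s (above-c cpar s≢p s≢c sv s≢v) s≢c)

      -- Were v below p in `F'`, the connected new subtree of p, which does not contain c, would
      -- witness `SameComp`.
      stays-c : ∀ {v} → Par (Desc F) c v → ¬ SameComp v → Par (Desc F') c v
      stays-c {v} cpar@(cv , c≢v , m) ¬same = proj₂ top (T.tr (proj₁ par) cv) , c≢v , minimal
        where
        v≢p : v ≢ p
        v≢p refl = par-asym g par cv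
        ¬pv : ¬ Desc F' p v
        ¬pv pv = ¬same λ w vw → reach-mono
          (λ px → p-⊆ px , λ { refl → par-asym g' par' px })
          (T'.conn (T'.tr pv (proj₁ (ag v v≢p (≢-sym c≢v)) vw)))
        minimal : ∀ s → Desc F' s v → s ≢ v → Desc F' s c
        minimal s sv s≢v with s ≟ p | s ≟ c
        ... | yes refl | _        = contradiction sv ¬pv
        ... | no _     | yes refl = self
        ... | no s≢p   | no s≢c   = proj₁ (ag s s≢p s≢c) (above-c cpar s≢p s≢c sv s≢v)

      -- The delicate case is q = p. By `par-adj`, p has a neighbour in the subtree of v, so p and v
      -- remain comparable, and v cannot rise above p.
      keeps : ∀ {v q} → v ≢ p → v ≢ c → q ≢ c → Par (Desc F) q v → Par (Desc F') q v
      keeps {v} {q} v≢p v≢c q≢c qpar@(qv , q≢v , m) = qv' , q≢v , minimal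
        where
        ¬vp : Desc F p v → ¬ Desc F' v p
        ¬vp pv vp = v≢p (T.antisym (proj₂ (proj₂ par) v (proj₂ (ag v v≢p v≢c) (proj₂ (proj₂ par') v vp v≢p)) v≢c) pv)
        qv' : Desc F' q v
        qv' with q ≟ p
        ... | no q≢p = proj₁ (ag q q≢p q≢c) qv
        ... | yes refl with par-adj g qpar
        ...   | w , vw , e with T'.adj e
        ...     | inj₂ wp = contradiction (T'.tr (proj₁ (ag v v≢p v≢c) vw) wp) (¬vp qv)
        ...     | inj₁ pw with T'.chain pw (proj₁ (ag v v≢p v≢c) vw)
        ...       | inj₁ pv = pv
        ...       | inj₂ vp = contradiction vp (¬vp qv)
        below-q : ∀ {s} → Desc F p v → Desc F' s v → q ≢ p → (Desc F' q s → Desc F q p) → Desc F' s q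
        below-q pv sv q≢p f with T'.chain sv qv'
        ... | inj₁ sq = sq
        ... | inj₂ qs = contradiction (T.antisym (f qs) (m p pv (≢-sym v≢p))) q≢p
        minimal : ∀ s → Desc F' s v → s ≢ v → Desc F' s q
        minimal s sv s≢v with s ≟ p | s ≟ c | q ≟ p
        ... | yes refl | _        | yes refl = self
        ... | yes refl | _        | no q≢p   = below-q (p-⊆ sv) sv q≢p (proj₂ (ag q q≢p q≢c))
        ... | no _     | yes refl | yes refl = proj₁ par'
        ... | no _     | yes refl | no q≢p   = below-q (proj₁ top sv) sv q≢p
                                                 (λ qc → proj₂ (proj₂ par) q (proj₂ (ag q q≢p q≢c) qc) q≢c)
        ... | no s≢p   | no s≢c   | _        =
          proj₁ (ag s s≢p s≢c) (m s (proj₂ (ag s s≢p s≢c) sv) s≢v)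

      ancestor-back : ∀ {q v} → v ≢ p → v ≢ c → Desc F' q v → q ≢ v → ∃ λ s → Desc F s v × s ≢ v
      ancestor-back {q} {v} v≢p v≢c d q≢v with q ≟ p | q ≟ c
      ... | yes refl | _        = p , p-⊆ d , q≢v
      ... | no _     | yes refl = p , proj₁ top d , ≢-sym v≢p
      ... | no q≢p   | no q≢c   = q , proj₂ (ag q q≢p q≢c) d , q≢v

      unchanged : ∀ v → v ≢ p → v ≢ c → lookup F v ≢ just c → lookup F' v ≡ lookup F v
      unchanged v v≢p v≢c nc = just-ext back forth
        where
        forth : ∀ q → lookup F v ≡ just q → lookup F' v ≡ just q
        forth q e = par⇒lookup g' (keeps v≢p v≢c (λ { refl → nc e }) (lookup⇒par g e))
        back : ∀ q → lookup F' v ≡ just q → lookup F v ≡ just q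
        back q e with lookup⇒par g' e
        ... | qv , q≢v , _ with ancestor-back v≢p v≢c qv q≢v
        ...   | s , sv , s≢v with par-exists (proj₁ g) (desc? F) sv s≢v
        ...     | t , tpar = trans eq (trans (sym (forth t eq)) e)
          where
          eq : lookup F v ≡ just t
          eq = par⇒lookup g tpar

    rot : Rot G F p c F'
    rot = just-ext
            (λ q e → par⇒lookup g (rotated-parent g' g (agreeOff-sym (agreeOff-swap ag)) par' par (lookup⇒par g' e)))
            (λ q e → par⇒lookup g' (rotated-parent g g' ag par par' (lookup⇒par g e)))
        , par⇒lookup g' par'
        , (λ v e → (λ same → par⇒lookup g' (joins-p (lookup⇒par g e) same))
                 , (λ ¬same → par⇒lookup g' (stays-c (lookup⇒par g e) ¬same)))
        , unchanged

  -- Every entry of the result is prescribed, but for the children of c only after deciding which of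
  -- the two cases applies.
  rot-functional : ∀ {G : Graph n} {F F' F'' : Forest n} {p c} → Rot G F p c F' → Rot G F p c F'' → F' ≡ F''
  rot-functional {G} {F} {F'} {F''} {p} {c} (a , b , d , e) (a' , b' , d' , e') = lookup-ext eq
    where
    eq : ∀ v → lookup F' v ≡ lookup F'' v
    eq v with v ≟ p | v ≟ c | maybe-≡-dec _≟_ (lookup F v) (just c)
    ... | yes refl | _ | _ = trans b (sym b')
    ... | no _ | yes refl | _ = trans a (sym a')
    ... | no v≢p | no v≢c | no ne = trans (e v v≢p v≢c ne) (sym (e' v v≢p v≢c ne))
    ... | no v≢p | no v≢c | yes ch
      with all? (λ w → desc? F v w →-dec reach? {G = G} (λ x → desc? F p x ×-dec ¬? (x ≟ c)) p w)
    ...   | yes same = trans (proj₁ (d v ch) same) (sym (proj₁ (d' v ch) same))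
    ...   | no ¬same = trans (proj₂ (d v ch) ¬same) (sym (proj₂ (d' v ch) ¬same))

  abstract
    rot-exists : ∀ {G : Graph n} {F : Forest n} {p c} → Good G F → Par (Desc F) p c →
      ∃ λ F' → Good G F' × AgreeOff p c F F' × F ≢ F' × Desc F' c p × Rot G F p c F'
    rot-exists g par with rotate g par
    ... | F' , g' , ag , eq = F' , g' , ag , (λ { refl → par-asym g par (proj₂ eq self) }) , proj₂ eq self ,
                              rot g g' ag par eq

  -- The given result is compared with the constructed rotation: they agree because `Rot` is
  -- functional, and in the converse because `Edge` is deterministic.
  rotEdge⇒edge : ∀ {G : Graph n} {F F' : Forest n} {i j} → Good G F → i <ᶠ j → RotEdge G F i j F' → Edge G i j F F'
  rotEdge⇒edge {G} {F} {F'} {i} {j} g lt (inj₁ (e , r)) with rot-exists g (lookup⇒par g e)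
  ... | F'' , g' , ag , ne , _ , r' with refl ← rot-functional {G} {F} {F'} {F''} {i} {j} r r' = edge lt g g' ag ne
  rotEdge⇒edge {G} {F} {F'} {i} {j} g lt (inj₂ (e , r)) with rot-exists g (lookup⇒par g e)
  ... | F'' , g' , ag , ne , _ , r' with refl ← rot-functional {G} {F} {F'} {F''} {j} {i} r r' =
    edge lt g g' (agreeOff-swap ag) ne

  edge⇒rotEdge : ∀ {G : Graph n} {F F' : Forest n} {i j} → Edge G i j F F' → RotEdge G F i j F'
  edge⇒rotEdge e@(edge lt g g' ag _) with edge-par e
  ... | inj₁ (par , _) with rot-exists g par
  ...   | _ , h , ag' , ne , _ , r with refl ← edge-deterministic e (edge lt g h ag' ne) =
    inj₁ (par⇒lookup g par , r)
  edge⇒rotEdge e@(edge lt g g' ag _) | inj₂ (par , _) with rot-exists g par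
  ...   | _ , h , ag' , ne , _ , r with refl ← edge-deterministic e (edge lt g h (agreeOff-swap ag') ne) =
    inj₂ (par⇒lookup g par , r)

  module Component (G : Graph n) {P : Fin n → Set} (P? : ∀ x → Dec (P x)) where

    abstract
      component : Fin n → Sub.Subset n
      component x = tabulate λ y → does (reach? {G = G} P? x y)

      component⁺ : ∀ {x y} → Reach G P x y → y Sub.∈ component x
      component⁺ {x} {y} r = lookup⇒[]= y _ (trans (lookup∘tabulate _ y) (dec-true (reach? P? x y) r))

      component⁻ : ∀ {x y} → y Sub.∈ component x → Reach G P x y
      component⁻ {x} {y} y∈ = decidable-stable (reach? P? x y) λ ¬r → contradiction
        (trans (sym (dec-false (reach? P? x y) ¬r)) (trans (sym (lookup∘tabulate _ y)) ([]=⇒lookup y∈))) λ ()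

    isComponent : ∀ {x} → P x → IsComponent G P (component x)
    isComponent {x} px =
      (λ v v∈ → reach-target (component⁻ v∈)) ,
      (x , component⁺ (here px)) ,
      (λ u v u∈ v∈ → reach-trans (reach-sym (within u∈)) (within v∈)) ,
      λ u v u∈ pv e → component⁺ (reach-snoc (component⁻ u∈) e pv)
      where
      within : ∀ {v} → v Sub.∈ component x → Reach G (Sub._∈ component x) x v
      within v∈ = reach-mono component⁺ (reach-self (component⁻ v∈))

  -- Elimination forests and connected subtrees

  module _ (G : Graph n) (F : Forest n) where

    et-root : ∀ {C a} → ET G F C a → Fin n
    et-root (node r _ _ _) = r

    et-root-lookup : ∀ {C a} (t : ET G F C a) → lookup F (et-root t) ≡ a
    et-root-lookup (node _ _ e _) = e

    Subtree : Sub.Subset n → Fin n → Fin n → Set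
    Subtree C r x = x Sub.∈ C × x ≢ r

    subtree? : ∀ C r x → Dec (Subtree C r x)
    subtree? C r x = (x ∈? C) ×-dec ¬? (x ≟ r)

    open module Sub-component C r = Component G (subtree? C r)

    et-desc : ∀ {C a} (t : ET G F C a) {v} → v Sub.∈ C → Desc F (et-root t) v
    et-desc {C} (node r r∈ e kids) {v} v∈ with v ≟ r
    ... | yes refl = self
    ... | no v≢r   = let t = kids (component C r v) (isComponent C r (v∈ , v≢r)) in
      desc-trans (down (et-root-lookup t) self) (et-desc t (component⁺ C r (here (v∈ , v≢r))))

    et-adj : ∀ {C a} → ET G F C a → ∀ {u v} → u Sub.∈ C → v Sub.∈ C → Adj G u v → Desc F u v ⊎ Desc F v u
    et-adj {C} t@(node r r∈ _ kids) {u} {v} u∈ v∈ e with u ≟ r | v ≟ r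
    ... | yes refl | _        = inj₁ (et-desc t v∈)
    ... | no _     | yes refl = inj₂ (et-desc t u∈)
    ... | no u≢r   | no v≢r   = et-adj (kids (component C r u) (isComponent C r (u∈ , u≢r)))
      (component⁺ C r (here (u∈ , u≢r))) (component⁺ C r (step (u∈ , u≢r) e (here (v∈ , v≢r)))) e

    -- `K` collects the vertices above the current tree. A cycle through the root r would force r
    -- into `K`, which is disjoint from C; below r the recursion adds r to `K`.
    et-acyclic : ∀ {C a} → ET G F C a → (K : Fin n → Set) → (∀ {x} → a ≡ just x → K x) →
      (∀ {x y} → K x → lookup F x ≡ just y → K y) → (∀ {x} → K x → ¬ x Sub.∈ C) →
      ∀ {v p} → v Sub.∈ C → lookup F v ≡ just p → ¬ Desc F v p
    et-acyclic {C} (node r r∈ e kids) K ka up disjoint {v} {p} v∈ ep d with v ≟ r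
    ... | yes refl = disjoint (closed (ka (trans (sym e) ep)) d) r∈
      where
      closed : ∀ {x y} → K x → Desc F y x → K y
      closed k self        = k
      closed k (down e' d) = closed (up k e') d
    ... | no v≢r =
      et-acyclic (kids (component C r v) (isComponent C r (v∈ , v≢r))) (λ x → K x ⊎ x ≡ r)
        (λ { refl → inj₂ refl })
        (λ { (inj₁ k) e' → inj₁ (up k e') ; (inj₂ refl) e' → inj₁ (ka (trans (sym e) e')) })
        (λ { (inj₁ k) x∈ → disjoint k (proj₁ (reach-target (component⁻ C r x∈)))
           ; (inj₂ refl) x∈ → proj₂ (reach-target (component⁻ C r x∈)) refl })
        (component⁺ C r (here (v∈ , v≢r))) ep d

    -- If v is the root of a component D of C minus r, its parent is r, and since C is connected
    -- some edge enters D; as D is closed, that edge starts at r.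
    et-conn : ∀ {C a} (t : ET G F C a) → (∀ u v → u Sub.∈ C → v Sub.∈ C → Reach G (Sub._∈ C) u v) →
              ∀ {v p} → v Sub.∈ C → v ≢ et-root t → lookup F v ≡ just p → Reach G (Desc F p) p v
    et-conn {C} t@(node r r∈ e kids) connected {v} {p} v∈ v≢r ep = cases (v ≟ et-root t')
      where
      D  = component C r v
      isC = isComponent C r (v∈ , v≢r)
      t' = kids D isC
      v∈D : v Sub.∈ D
      v∈D = component⁺ C r (here (v∈ , v≢r))
      cases : Dec (v ≡ et-root t') → Reach G (Desc F p) p v
      cases (no v≢r') = et-conn (kids D isC) (proj₁ (proj₂ (proj₂ isC))) v∈D v≢r' ep
      cases (yes v≡r')
        with refl ← just-injective (trans (sym ep) (trans (cong (lookup F) v≡r') (et-root-lookup t')))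
        with reach-exit (λ x → x ∈? D) (connected r v r∈ v∈)
               (λ r∈D → proj₂ (reach-target (component⁻ C r r∈D)) refl) v∈D
      ... | x , y , x∈C , x∉D , e' , y∈D with x ≟ r
      ...   | no x≢r = contradiction
                (proj₂ (proj₂ (proj₂ isC)) y x y∈D (x∈C , x≢r) (adj-sym G e')) x∉D
      ...   | yes refl = step self e' (reach-mono (λ z∈D → et-desc t (proj₁ (reach-target (component⁻ C r z∈D))))
                (proj₁ (proj₂ (proj₂ isC)) y v y∈D v∈D))

    open Component G {P = λ _ → ⊤} (λ _ → yes tt) renaming
      (component to whole; component⁺ to whole⁺; component⁻ to whole⁻; isComponent to whole-isComponent)

    elim⇒good : IsElimForest G F → Good G F
    elim⇒good el = record
      { rfl = self ; antisym = antisym ; tr = desc-trans ; chain = desc-chain ; adj = adj ; conn = conn } ,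
      λ v e → acyclic e self
      where
      tree : ∀ x → ET G F (whole x) nothing
      tree x = el (whole x) (whole-isComponent tt)
      x∈ : ∀ {x} → x Sub.∈ whole x
      x∈ = whole⁺ (here tt)
      acyclic : ∀ {v p} → lookup F v ≡ just p → ¬ Desc F v p
      acyclic {v} = et-acyclic (tree v) (λ _ → ⊥) (λ ()) (λ ()) (λ ()) x∈
      antisym : ∀ {u v} → Desc F u v → Desc F v u → u ≡ v
      antisym self       _  = refl
      antisym (down e d) d' = contradiction (desc-trans d' d) (acyclic e)
      adj : ∀ {u v} → Adj G u v → Desc F u v ⊎ Desc F v u
      adj {u} e = et-adj (tree u) x∈ (whole⁺ (step tt e (here tt))) e
      parent-reach : ∀ {v p} → lookup F v ≡ just p → Reach G (Desc F p) p v
      parent-reach {v} e = et-conn (tree v) (proj₁ (proj₂ (proj₂ (whole-isComponent tt)))) x∈ notRoot e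
        where
        notRoot : v ≢ et-root (tree v)
        notRoot eq with () ← trans (sym e) (trans (cong (lookup F) eq) (et-root-lookup (tree v)))
      conn : ∀ {u v} → Desc F u v → Reach G (Desc F u) u v
      conn self       = here self
      conn (down e d) = reach-trans (conn d) (reach-mono (desc-trans d) (parent-reach e))

    module _ (g : Good G F) where
      private module T = Tubing (proj₁ g)

      component-tube : ∀ {P r x D} → IsComponent G P D → (∀ {y} → P y → Desc F y r → y ≡ r) →
        (∀ {y} → Desc F r y → P y) → x Sub.∈ D → Desc F r x →
        (∀ {w} → w Sub.∈ D → Desc F r w) × (∀ {w} → Desc F r w → w Sub.∈ D)
      component-tube {P} {r} {x} {D} (D⊆P , _ , conn , cl) avoid below x∈ rx =
        (λ w∈ → T.tube⁺ (reach-trans (T.tube⁻ rx) (reach-mono (λ z∈ → avoid (D⊆P _ z∈)) (conn _ _ x∈ w∈)))) ,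
        λ rw → proj₂ (reach-target (reach-restrict (λ y∈ _ py e → cl _ _ y∈ py e) x∈
                 (reach-mono below (reach-trans (reach-sym (T.conn rx)) (T.conn rw)))))

      -- A component of the subtree of r minus r is the subtree of the child of r above any one of
      -- its vertices.
      tube⇒et : ∀ {C a} r → Acc (λ y x → Desc F x y × x ≢ y) r → lookup F r ≡ a →
                (∀ {w} → w Sub.∈ C → Desc F r w) → (∀ {w} → Desc F r w → w Sub.∈ C) → ET G F C a
      tube⇒et {C} r (acc rs) e to from = node r (from self) e kids
        where
        kids : ∀ D → IsComponent G (λ v → v Sub.∈ C × v ≢ r) D → ET G F D (just r)
        kids D isC@(D⊆ , (x , x∈) , _) with child-exists (proj₁ g) (desc? F) (to (proj₁ (D⊆ x x∈))) (≢-sym (proj₂ (D⊆ x x∈)))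
        ... | c , par@(rc , r≢c , m) , cx = tube⇒et c (rs (rc , r≢c)) (par⇒lookup g par) (proj₁ same) (proj₂ same)
          where
          avoid : ∀ {y} → y Sub.∈ C × y ≢ r → Desc F y c → y ≡ c
          avoid {y} (y∈ , y≢r) yc with y ≟ c
          ... | yes eq = eq
          ... | no y≢c = contradiction (T.antisym (m y yc y≢c) (to y∈)) y≢r
          same = component-tube isC avoid
            (λ cy → from (T.tr rc cy) , λ { refl → r≢c (T.antisym rc cy) }) x∈ cx

      good⇒elim : IsElimForest G F
      good⇒elim D isC@(_ , (x , x∈) , _) with top x (T.ancestors-wf x)
        where
        top : ∀ y → Acc (λ x y → Desc F x y × x ≢ y) y → ∃ λ r → Desc F r y × lookup F r ≡ nothing
        top y (acc rs) with lookup F y in e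
        ... | nothing = y , self , e
        ... | just p with lookup⇒par g e
        ...   | py , p≢y , _ with top p (rs (py , p≢y))
        ...     | r , rp , er = r , T.tr rp py , er
      ... | r , rx , er = tube⇒et r (T.descendants-wf r) er (proj₁ same) (proj₂ same)
        where
        avoid : ∀ {y} → ⊤ → Desc F y r → y ≡ r
        avoid _ self = refl
        avoid _ (down e _) with () ← trans (sym e) er
        same = component-tube isC avoid (λ _ → tt) x∈ rx

-- Runs of the algorithm

vectors : {X : Set} → List X → ∀ n → List (Vec X n)
vectors xs zero    = [] ∷ []
vectors xs (suc n) = cartesianProductWith _∷_ xs (vectors xs n)

vectors-complete : {X : Set} {xs : List X} → (∀ x → x ∈ xs) → ∀ {n} (v : Vec X n) → v ∈ vectors xs n
vectors-complete all []      = here refl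
vectors-complete all (x ∷ v) = ∈-cartesianProductWith⁺ _∷_ (all x) (vectors-complete all v)

largest : ∀ {n} {P : Fin n → Set} → (∀ j → Dec (P j)) →
          (∀ j → ¬ P j) ⊎ ∃ λ j → P j × (∀ j' → j <ᶠ j' → ¬ P j')
largest {n} {P} P? with any? P?
... | no none     = inj₁ λ j p → none (j , p)
... | yes (j , p) = inj₂ (ascend j (>-wellFounded j) p)
  where
  ascend : ∀ j → Acc (λ x y → y <ᶠ x) j → P j → ∃ λ j → P j × (∀ j' → j <ᶠ j' → ¬ P j')
  ascend j (acc rs) p with any? (λ j' → (j <? j') ×-dec P? j')
  ... | yes (j' , lt , p') = ascend j' (rs lt) p'
  ... | no none            = j , p , λ j' lt p' → none (j' , lt , p')

module _ {n : ℕ} where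

  forests : List (Forest n)
  forests = vectors (nothing ∷ map just (allFin n)) n

  ∈-forests : (F : Forest n) → F ∈ forests
  ∈-forests = vectors-complete λ { nothing → here refl ; (just x) → there (∈-map⁺ just (∈-allFin x)) }

  abstract
    someForest? : {P : Forest n → Set} → (∀ F → Dec (P F)) → Dec (∃ P)
    someForest? P? = map′ (λ a → let F , _ , p = find a in F , p) (λ (F , p) → lose (∈-forests F) p)
                       (Any.any? P? forests)

    good? : (G : Graph n) → ∀ F → Dec (Good G F)
    good? G F = map′
      (λ (antisym , adj , conn , loopless) →
         record { rfl = self ; antisym = antisym _ _ ; tr = desc-trans ; chain = desc-chain
                ; adj = adj _ _ ; conn = conn _ _ } , loopless)
      (λ (t , loopless) → let open Tubing t in
         (λ _ _ → antisym) , (λ _ _ → adj) , (λ _ _ → conn) , loopless)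
      ((all? λ u → all? λ v → desc? F u v →-dec (desc? F v u →-dec u ≟ v))
       ×-dec (all? λ u → all? λ v → adj? G u v →-dec (desc? F u v ⊎-dec desc? F v u))
       ×-dec (all? λ u → all? λ v → desc? F u v →-dec reach? (desc? F u) u v)
       ×-dec all? λ v → ¬? (maybe-≡-dec _≟_ (lookup F v) (just v)))

    agreeOff? : ∀ i j F F' → Dec (AgreeOff {n} i j F F')
    agreeOff? i j F F' = map′
      (λ f u u≢i u≢j → (λ {w} → proj₁ (f u u≢i u≢j w)) , λ {w} → proj₂ (f u u≢i u≢j w))
      (λ f u u≢i u≢j w → proj₁ (f u u≢i u≢j) , proj₂ (f u u≢i u≢j))
      (all? λ u → ¬? (u ≟ i) →-dec (¬? (u ≟ j) →-dec
        all? λ w → (desc? F u w →-dec desc? F' u w) ×-dec (desc? F' u w →-dec desc? F u w)))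

    edge? : ∀ G i j F F' → Dec (Edge {n} G i j F F')
    edge? G i j F F' = map′
      (λ (a , b , c , d , e) → edge a b c d e) (λ (edge a b c d e) → a , b , c , d , e)
      ((i <? j) ×-dec good? G F ×-dec good? G F' ×-dec agreeOff? i j F F' ×-dec ¬? (forest-≟ F F'))

  _∈ᶠ?_ : (F : Forest n) (V : List (Forest n)) → Dec (F ∈ V)
  F ∈ᶠ? V = Any.any? (forest-≟ F) V

  module _ (G : Graph n) where

    fresh? : ∀ V {F} → Good G F → ∀ i j → Dec (Fresh G V F i j)
    fresh? V {F} g i j = map′
      (λ (F' , e , F'∉) → Edge.i<j e , F' , edge⇒rotEdge e , F'∉)
      (λ (lt , F' , r , F'∉) → F' , rotEdge⇒edge g lt r , F'∉)
      (someForest? λ F' → edge? G i j F F' ×-dec ¬? (F' ∈ᶠ? V))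

    stop-or-step : ∀ V {F} → Good G F → Stop G V F ⊎ ∃ λ F' → Step G V F F'
    stop-or-step V {F} g with largest (λ j → any? (λ i → fresh? V g i j))
    ... | inj₁ none = inj₁ (inj₁ none)
    ... | inj₂ (j , (i , fr@(lt , F' , r , F'∉)) , max)
      with any? (λ i' → ¬? (i' ≟ i) ×-dec fresh? V g i' j)
    ...   | yes (i' , ne , fr') = inj₁ (inj₂ (j , ((i , fr) , max) , i' , i , ne , fr' , fr))
    ...   | no none = inj₂ (F' , j , i , ((i , fr) , max) , lt , r , F'∉ ,
              λ i' fr' → decidable-stable (i' ≟ i) λ ne → none (i' , ne , fr'))

    step-good : ∀ {V F F'} → Good G F → Step G V F F' → Good G F' × F' ∉ V
    step-good g (j , i , _ , lt , r , F'∉ , _) = Edge.good′ (rotEdge⇒edge g lt r) , F'∉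

    -- `R` contains all unvisited forests and loses one of them with each step, so its length bounds
    -- the run.
    run-exists : ∀ k {V F} (R : List (Forest n)) → length R ≤ k → (∀ {F'} → F' ∉ V → F' ∈ R) → Good G F →
                 ∃ λ L → Run G V F L
    run-exists k {V} {F} R le unvisited g with stop-or-step V g
    ... | inj₁ s = V , stop s
    ... | inj₂ (F' , s) with step-good {V} {F} {F'} g s
    ...   | g' , F'∉ = continue k le
      where
      other? : ∀ x → Dec (x ≢ F')
      other? x = ¬? (forest-≟ x F')
      shorter : length (filter other? R) < length R
      shorter = filter-notAll other? R (Any.map (λ eq ne → ne (sym eq)) (unvisited F'∉))
      continue : ∀ k → length R ≤ k → ∃ λ L → Run G V F L
      continue zero    le = contradiction (≤-trans shorter le) λ ()
      continue (suc k) le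
        with run-exists k {F' ∷ V} (filter other? R) (s≤s⁻¹ (≤-trans shorter le))
               (λ x∉ → ∈-filter⁺ other? (unvisited (x∉ ∘ there)) (x∉ ∘ here)) g'
      ... | L , run = L , go s run

    run-greedy : ∀ {V F L} → Run G V F L → Good G F → F ∈ V → ∃ λ fs →
      Greedy G (F ∷ fs) × Unique (F ∷ fs) × (∀ {x} → x ∈ fs → x ∉ V × Good G x) ×
      (∀ {x} → x ∈ L → x ∈ V ⊎ x ∈ fs)
    run-greedy (stop _) g F∈ = [] , [-] , All.[] ∷ [] , (λ ()) , inj₁
    run-greedy {V} {F} (go {F' = F'} (j , i , (_ , max) , lt , r , F'∉ , only) run) g F∈
      with rotEdge⇒edge g lt r
    ... | e with run-greedy run (Edge.good′ e) (here refl)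
    ...   | fs , gr , u , new , all = F' ∷ fs , (e ∷⟨ later ⟩ gr) ,
            All.tabulate (λ x∈ eq → proj₁ (new' x∈) (subst (_∈ V) eq F∈)) ∷ u , new' , all'
      where
      new' : ∀ {x} → x ∈ F' ∷ fs → x ∉ V × Good G x
      new' (here refl) = F'∉ , Edge.good′ e
      new' (there x∈)  = proj₁ (new x∈) ∘ there , proj₂ (new x∈)
      all' : ∀ {x} → x ∈ _ → x ∈ V ⊎ x ∈ F' ∷ fs
      all' x∈ with all x∈
      ... | inj₁ (here refl) = inj₂ (here refl)
      ... | inj₁ (there x∈V) = inj₁ x∈V
      ... | inj₂ x∈fs        = inj₂ (there x∈fs)
      -- A later z was unvisited at `F`, so its label is at most j. Equality would give i' = i by
      -- uniqueness and then z = `F'`, which was visited before z.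
      later : ∀ {z i' j'} → z ∈ fs → Edge G i' j' F z → j' <ᶠ j
      later {z} {i'} {j'} z∈ e' with Finₚ.<-cmp j' j
      ... | tri< lt' _ _ = lt'
      ... | tri≈ _ refl _ with refl ← only i' (Edge.i<j e' , z , edge⇒rotEdge e' , proj₁ (new z∈) ∘ there) =
        contradiction (here (edge-deterministic e' e)) (proj₁ (new z∈))
      ... | tri> _ _ gt = contradiction
              (i' , Edge.i<j e' , z , edge⇒rotEdge e' , proj₁ (new z∈) ∘ there) (max j' gt)

    run-exhaustive : ∀ {F L} → Run G (F ∷ []) F L → Good G F → (∀ {F'} → Good G F' → F' ∈ L) → Exhaustive G
    run-exhaustive {F} run g all with run-greedy run g (here refl)
    ... | fs , gr , u , new , covers = record
      { first = F ; rest = fs ; greedy = gr ; unique = u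
      ; good = λ { (here refl) → g ; (there x∈) → proj₂ (new x∈) }
      ; complete = λ g' → complete (covers (all g')) }
      where
      complete : ∀ {x} → x ∈ F ∷ [] ⊎ x ∈ fs → x ∈ F ∷ fs
      complete (inj₁ (here refl)) = here refl
      complete (inj₂ x∈)          = there x∈

  -- Deleting all vertices from a threshold on

  record Restricted (G : Graph n) (k : ℕ) : Set where
    field
      H          : Graph n
      exhaustive : Exhaustive H
      H≤G        : H ≤ᴳ G
      -- With `H≤G` and `bounded`, this says that H is G with every vertex from k on isolated.
      keeps      : ∀ {u w} → toℕ u < k → toℕ w < k → Adj G u w → Adj H u w
      bounded    : ∀ {u w} → Adj H u w → toℕ u < k

  restrict-one : ∀ {G k} → k < n → Restricted G (suc k) → Restricted G k
  restrict-one {G} {k} k<n res = record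
    { H          = isolate v H
    ; exhaustive = Top.Quotient.quotient H v above exhaustive
    ; H≤G        = λ e → H≤G (isolate-≤ H e)
    ; keeps      = λ {u} {w} u<k w<k e → isolate-adj⁺ H (below u<k) (below w<k)
                     (keeps (≤-trans u<k (ℕₚ.n≤1+n k)) (≤-trans w<k (ℕₚ.n≤1+n k)) e)
    ; bounded    = λ {u} e → ≤∧≢⇒< (s≤s⁻¹ (bounded (isolate-≤ H e)))
                     λ eq → proj₁ (isolate-adj⁻ H e) (toℕ-injective (trans eq (sym v≡k)))
    }
    where
    open Restricted res
    v : Fin n
    v = fromℕ< k<n
    v≡k : toℕ v ≡ k
    v≡k = Finₚ.toℕ-fromℕ< k<n
    above : ∀ {u w} → Adj H u w → u ≤ᶠ v
    above e = subst (_ ≤_) (sym v≡k) (s≤s⁻¹ (bounded e))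
    below : ∀ {u} → toℕ u < k → u ≢ v
    below u<k refl = ℕₚ.<-irrefl v≡k u<k

  restrict : ∀ {G} d k → d + k ≤ n → Restricted G (d + k) → Restricted G k
  restrict zero    k le res = res
  restrict (suc d) k le res = restrict d k (≤-trans (ℕₚ.n≤1+n _) le) (restrict-one le res)

  -- The forest with three v-neighbours

  module _ (G : Graph n) where

    abstract
      -- Delete w and insert it again as a root. The other subtrees are bounded from above by the
      -- old ones without w, and from below by reachability that avoids w.
      to-root : ∀ w {F} → Good G F → ∃ λ F' → Good G F' ×
        (∀ {u} → Reach G (λ _ → ⊤) w u → Desc F' w u) ×
        (∀ {u x} → u ≢ w → Desc F' u x → Desc F u x × x ≢ w) ×
        (∀ {u x} → u ≢ w → Reach (isolate w G) (Desc F u) u x → Desc F' u x)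
      to-root w {F} g with insert (contract-good g)
        where open Contract G w
      ... | F' , g' , eq = F' , g' , (λ r → proj₂ (eq w) (root r)) , shrink ,
        λ u≢w r → proj₂ (eq _) (below u≢w (proj₂ (contract-≐ g _) r))
        where
        open Contract G w
        shrink : ∀ {u x} → u ≢ w → Desc F' u x → Desc F u x × x ≢ w
        shrink u≢w d with proj₁ (eq _) d
        ... | root _    = contradiction refl u≢w
        ... | below _ e = contract-⊆ g e , λ { refl → u≢w (isolated-desc (contract-good g) e) }

    -- x and y are the cycle neighbours of v, and z is the other cycle neighbour of x; on a cycle of
    -- length four z and y are adjacent. The role of z is to sit above v, so that v has a parent.
    module Obstruction {v x y z : Fin n} (vx : Adj G v x) (vy : Adj G v y) (xz : Adj G x z)
      (¬xy : ¬ Adj G x y) (x≢y : x ≢ y) (z≢v : z ≢ v) where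

      v≢x : v ≢ x
      v≢x refl = adj-irrefl G vx
      v≢y : v ≢ y
      v≢y refl = adj-irrefl G vy
      x≢z : x ≢ z
      x≢z refl = adj-irrefl G xz
      y≢z : y ≢ z
      y≢z refl = ¬xy xz

      record Frame (F : Forest n) : Set where
        constructor frame
        field
          good : Good G F
          dvx  : Desc F v x
          dvy  : Desc F v y
          dzv  : Desc F z v

      Special : Fin n → Set
      Special w = w ≡ v ⊎ w ≡ x ⊎ w ≡ y ⊎ w ≡ z

      special? : ∀ w → Dec (Special w)
      special? w = (w ≟ v) ⊎-dec (w ≟ x) ⊎-dec (w ≟ y) ⊎-dec (w ≟ z)

      start : ∀ {F} → Good G F → ∃ Frame
      start g with to-root v g
      -- The vertex made a root last ends on top: z is moved after v. It is above v because of the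
      -- walk z, x, v.
      ... | F₁ , g₁ , all₁ , _ with to-root z g₁
      ...   | F₂ , g₂ , all₂ , _ , keep = F₂ , frame g₂
        (keep (≢-sym z≢v) (step self (isolate-adj⁺ G (≢-sym z≢v) x≢z vx) (here (all₁ (step tt vx (here tt))))))
        (keep (≢-sym z≢v) (step self (isolate-adj⁺ G (≢-sym z≢v) y≢z vy) (here (all₁ (step tt vy (here tt))))))
        (all₂ (step tt (adj-sym G xz) (step tt (adj-sym G vx) (here tt))))

      -- Making w a root expels it from the subtree of v. The frame survives because the walks v x,
      -- v y and z x v avoid every vertex that is not special.
      sweep : ∀ {F} → Frame F → (ws : List (Fin n)) →
              ∃ λ F' → Frame F' × (∀ {w} → w ∈ ws → Special w ⊎ ¬ Desc F' v w)
      sweep fr [] = _ , fr , λ ()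
      sweep fr (w ∷ ws) with sweep fr ws | special? w
      ... | F₁ , fr₁ , done | yes sp = F₁ , fr₁ , λ { (here refl) → inj₁ sp ; (there w∈) → done w∈ }
      ... | F₁ , frame g₁ dvx dvy dzv , done | no ¬sp with to-root w g₁
      ...   | F₂ , g₂ , _ , shrink , keep = F₂ , frame g₂
        (keep v≢w (step self (isolate-adj⁺ G v≢w x≢w vx) (here dvx)))
        (keep v≢w (step self (isolate-adj⁺ G v≢w y≢w vy) (here dvy)))
        (keep z≢w (step self (isolate-adj⁺ G z≢w x≢w (adj-sym G xz))
                  (step (desc-trans dzv dvx) (isolate-adj⁺ G x≢w v≢w (adj-sym G vx)) (here dzv)))) ,
        done'
        where
        v≢w : v ≢ w
        v≢w eq = ¬sp (inj₁ (sym eq))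
        x≢w : x ≢ w
        x≢w eq = ¬sp (inj₂ (inj₁ (sym eq)))
        y≢w : y ≢ w
        y≢w eq = ¬sp (inj₂ (inj₂ (inj₁ (sym eq))))
        z≢w : z ≢ w
        z≢w eq = ¬sp (inj₂ (inj₂ (inj₂ (sym eq))))
        done' : ∀ {u} → u ∈ w ∷ ws → Special u ⊎ ¬ Desc F₂ v u
        done' (here refl) = inj₂ λ d → proj₂ (shrink v≢w d) refl
        done' (there u∈) with done u∈
        ... | inj₁ sp = inj₁ sp
        ... | inj₂ ¬d = inj₂ λ d → ¬d (proj₁ (shrink v≢w d))

      not-exhaustive : (∀ {u w} → Adj G u w → u ≤ᶠ v) → ¬ Exhaustive G
      not-exhaustive above ex with start (Exhaustive.good ex (here refl))
      ... | _ , fr with sweep fr (allFin n)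
      ...   | F , frame g dvx dvy dzv , done = separated
              (Top.no-branching G v above (Top.Quotient.degree≤2 G v above ex) g dzv z≢v dvx v≢x dvy v≢y)
        where
        -- Below v only x and y can remain, so a walk from x that avoids v cannot leave x.
        separated : ¬ Reach G (λ u → Desc F v u × u ≢ v) x y
        separated (here _) = x≢y refl
        separated (step _ e r) with reach-source r
        ... | vw , w≢v with done (∈-allFin _)
        ...   | inj₂ ¬d                        = ¬d vw
        ...   | inj₁ (inj₁ eq)                 = w≢v eq
        ...   | inj₁ (inj₂ (inj₁ refl))        = adj-irrefl G e
        ...   | inj₁ (inj₂ (inj₂ (inj₁ refl))) = ¬xy e
        ...   | inj₁ (inj₂ (inj₂ (inj₂ refl))) = z≢v (sym (Tubing.antisym (proj₁ g) vw dzv))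

-- The cyclic order on an induced cycle and the conclusion

next : ∀ {k} (a : Fin k) → ∃ λ b → Next a b
next {suc k} a with suc (toℕ a) ℕ.<? suc k
... | yes lt = fromℕ< lt , inj₁ (sym (Finₚ.toℕ-fromℕ< lt))
... | no ¬lt = zero , inj₂ (≤-antisym (toℕ<n a) (≮⇒≥ ¬lt) , refl)

previous : ∀ {k} (a : Fin k) → ∃ λ b → Next b a
previous {suc k} zero    = fromℕ k , inj₂ (cong suc (Finₚ.toℕ-fromℕ k) , refl)
previous {suc k} (suc a) = inject₁ a , inj₁ (cong suc (Finₚ.toℕ-inject₁ a))

next-functional : ∀ {k} {a b b' : Fin k} → Next a b → Next a b' → b ≡ b'
next-functional (inj₁ e) (inj₁ e') = toℕ-injective (trans (sym e) e')
next-functional {b = b} (inj₁ e) (inj₂ (e' , _)) = contradiction (toℕ<n b) (ℕₚ.<-irrefl (trans (sym e) e'))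
next-functional {b' = b} (inj₂ (e' , _)) (inj₁ e) = contradiction (toℕ<n b) (ℕₚ.<-irrefl (trans (sym e) e'))
next-functional (inj₂ (_ , e)) (inj₂ (_ , e')) = toℕ-injective (trans e (sym e'))

module _ {k : ℕ} where

  -- `Next` on plain numbers, to which it unfolds; here the equations can be solved by matching on
  -- `refl`.
  Succ : ℕ → ℕ → Set
  Succ a b = suc a ≡ b ⊎ (suc a ≡ k × b ≡ 0)

  -- A closed chain of m cyclic successors makes k divide m, impossible for m at most three when k
  -- is at least four. The same reason serves the next two lemmas.
  no-fixed-point : ∀ {a} → 4 ≤ k → ¬ Succ a a
  no-fixed-point le (inj₂ (refl , refl)) with s≤s () ← le

  no-2-cycle : ∀ {a b} → 4 ≤ k → Succ a b → ¬ Succ b a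
  no-2-cycle le (inj₁ refl) (inj₂ (refl , refl)) with s≤s (s≤s ()) ← le
  no-2-cycle le (inj₂ (refl , refl)) (inj₁ refl) with s≤s (s≤s ()) ← le
  no-2-cycle le (inj₂ (refl , refl)) (inj₂ (refl , refl)) with s≤s () ← le

  no-3-cycle : ∀ {a b c} → 4 ≤ k → Succ a b → Succ b c → ¬ Succ c a
  no-3-cycle le (inj₁ refl) (inj₁ refl) (inj₂ (refl , refl)) with s≤s (s≤s (s≤s ())) ← le
  no-3-cycle le (inj₁ refl) (inj₂ (refl , refl)) (inj₁ refl) with s≤s (s≤s (s≤s ())) ← le
  no-3-cycle le (inj₂ (refl , refl)) (inj₁ refl) (inj₁ refl) with s≤s (s≤s (s≤s ())) ← le
  no-3-cycle le (inj₁ refl) (inj₂ (refl , refl)) (inj₂ (() , refl))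
  no-3-cycle le (inj₂ (refl , refl)) (inj₁ refl) (inj₂ (refl , ()))
  no-3-cycle le (inj₂ (refl , refl)) (inj₂ (refl , refl)) _ with s≤s () ← le

long-cycle⇒¬exhaustive : ∀ {n} (G : Graph n) {k c} → InducedCycle G k c → k ≢ 3 → ¬ Exhaustive G
long-cycle⇒¬exhaustive {n} G {suc k} {c} (3≤k , inj , adj⇔) k≢3 ex
  with largest (λ u → any? (λ a → c a ≟ u))
... | inj₁ none = none (c zero) (zero , refl)
... | inj₂ (v , (a , refl) , max) with next a | previous a
...   | a₁ , n₁ | b , n₀ with next a₁
...     | a₂ , n₂ =
  Obstruction.not-exhaustive H
    (keep (adj (inj₁ n₁))) (keep (adj (inj₂ n₀))) (keep (adj (inj₁ n₂)))
    (λ e → nonadjacent (Equivalence.to (adj⇔ a₁ b) (H≤G e)))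
    (λ eq → no-2-cycle 4≤k n₁ (subst (λ d → Next d a) (sym (inj eq)) n₀))
    (λ eq → no-2-cycle 4≤k n₁ (subst (Next a₁) (inj eq) n₂))
    (λ e → s≤s⁻¹ (bounded e)) exhaustive
  where
  4≤k : 4 ≤ suc k
  4≤k = ≤∧≢⇒< 3≤k (≢-sym k≢3)
  start : Restricted G n
  start = record { H = G ; exhaustive = ex ; H≤G = id ; keeps = λ _ _ e → e ; bounded = λ {u} _ → toℕ<n u }
  split : (n ℕ.∸ suc (toℕ (c a))) + suc (toℕ (c a)) ≡ n
  split = m∸n+n≡m (toℕ<n (c a))
  -- The threshold is one more than the label of v, so that v and with it the whole cycle survive.
  open Restricted (restrict _ (suc (toℕ (c a))) (≤-reflexive split) (subst (Restricted G) (sym split) start))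
  adj : ∀ {x y} → CycAdj x y → Adj G (c x) (c y)
  adj = Equivalence.from (adj⇔ _ _)
  small : ∀ x → toℕ (c x) < suc (toℕ (c a))
  small x = s≤s (≮⇒≥ λ lt → max (c x) lt (x , refl))
  keep : ∀ {x y} → Adj G (c x) (c y) → Adj H (c x) (c y)
  keep {x} {y} = keeps (small x) (small y)
  -- An adjacency of the two neighbours of a would close the cycle after three steps, or make a its
  -- own successor.
  nonadjacent : ¬ CycAdj a₁ b
  nonadjacent (inj₁ nb) = no-3-cycle 4≤k n₁ nb n₀
  nonadjacent (inj₂ nb) = no-fixed-point 4≤k (subst (Next a) (next-functional nb n₀) n₁)

theorem38 : (n : ℕ) (G : Graph n) → ¬ Chordal G →
    (F₀ : Forest n) → IsElimForest G F₀ →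
    Σ _ λ L → Run G (F₀ ∷ []) F₀ L × Σ (Forest n) λ F → IsElimForest G F × F ∉ L
theorem38 n G ¬chordal F₀ elim
  with run-exists G _ forests ≤-refl (λ {F} _ → ∈-forests F) (elim⇒good G F₀ elim)
... | L , run with someForest? (λ F → good? G F ×-dec ¬? (F ∈ᶠ? L))
...   | yes (F , g , F∉) = L , run , F , good⇒elim G F g , F∉
-- If no forest is missed, the run is exhaustive and G is shown to be chordal; a long cycle need not
-- be extracted from the negated hypothesis.
...   | no none = contradiction chordal ¬chordal
  where
  exhaustive : Exhaustive G
  exhaustive = run-exhaustive G run (elim⇒good G F₀ elim)
    λ {F} g → decidable-stable (F ∈ᶠ? L) λ F∉ → none (F , g , F∉)
  chordal : Chordal G
  chordal k c cyc = decidable-stable (k ℕ.≟ 3) λ k≢3 → long-cycle⇒¬exhaustive G cyc k≢3 exhaustive
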